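{- Let $f\in\mathbb{C}[Z]$ be a psd-stable polynomial on the space of complex symmetric $n\times n$ matrices. If an off-diagonal variable $z_{ij}$ (where $i<j$) occurs in $f$, then the corresponding diagonal variables $z_{ii}$ and $z_{jj}$ must also occur in $f$.
   Context: $\mathbb{C}[Z]$ denotes the ring of polynomials in the entries $z_{ij}$ of a symmetric $n\times n$ variable matrix $Z=(z_{ij})$, with $z_{ij}$ and $z_{ji}$ identified; equivalently, $\mathbb{C}[\{z_{ij} : 1\le i\le j\le n\}]$. A polynomial $f\in\mathbb{C}[Z]$ is psd-stable if $f(M)\ne 0$ for every complex symmetric $n\times n$ matrix $M$ whose entrywise imaginary part $\mathrm{Im}(M)$ is positive definite. A variable occurs in $f$ if it divides some monomial having non-zero coefficient in $f$. -}

module Defs where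

open import Algebra.Bundles using (CommutativeRing; RawRing)
import Algebra.Definitions.RawSemiring as RawSemiringDefs
import Algebra.Properties.Monoid.Sum as MonoidSum
open import Data.Bool.Base using (if_then_else_)
open import Data.Fin.Base as Fin using (Fin; Fin′; inject!; fromℕ<)
import Data.Fin.Properties as Fin
open import Data.List.Base using (List; []; _∷_)
open import Data.Nat.Base as ℕ using (ℕ; s≤s)
import Data.Nat.Properties as ℕ
open import Data.Product.Base using (Σ-syntax; ∃; _×_; _,_; proj₁; proj₂; curry; uncurry)
open import Level using (0ℓ)
open import Relation.Binary.Core using (Rel)
open import Relation.Binary.PropositionalEquality.Core using (_≗_)
open import Relation.Binary.Structures using (IsStrictTotalOrder)
import Relation.Binary.Construct.StrictToNonStrict as NonStrict
open import Relation.Nullary.Decidable.Core using (Dec; does; map′)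
open import Relation.Nullary.Negation.Core using (¬_)
open import Relation.Unary using (Pred; Satisfiable)

-- The standard library has no real numbers.  They are given here by their
-- classical axioms: a Dedekind-complete, totally ordered field.  Such a field
-- is unique up to isomorphism, so a statement about all of them is a statement
-- about ℝ.

record CompleteOrderedField : Set₁ where
  infix 4 _<_
  field
    commutativeRing : CommutativeRing 0ℓ 0ℓ

  open CommutativeRing commutativeRing public

  field
    _<_                : Rel Carrier 0ℓ
    isStrictTotalOrder : IsStrictTotalOrder _≈_ _<_
    1≉0                : ¬ (1# ≈ 0#)
    inverse            : ∀ x → ¬ (x ≈ 0#) → ∃ λ y → x * y ≈ 1#
    +-monoˡ-<          : ∀ z {x y} → x < y → x + z < y + z
    *-pos              : ∀ {x y} → 0# < x → 0# < y → 0# < x * y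

  open NonStrict _≈_ _<_ public using (_≤_)

  UpperBound : Pred Carrier 0ℓ → Pred Carrier 0ℓ
  UpperBound S u = ∀ x → S x → x ≤ u

  LeastUpperBound : Pred Carrier 0ℓ → Pred Carrier 0ℓ
  LeastUpperBound S s = UpperBound S s × (∀ u → UpperBound S u → s ≤ u)

  field
    complete : (S : Pred Carrier 0ℓ) → Satisfiable S →
               Satisfiable (UpperBound S) → Satisfiable (LeastUpperBound S)

Matrix : Set → ℕ → Set
Matrix A n = Fin n → Fin n → A

-- The variables of a symmetric n × n matrix are indexed by the positions on or
-- above the diagonal: a column j together with a row in {0, …, j}.

Variable : ℕ → Set
Variable n = Σ[ j ∈ Fin n ] Fin′ (Fin.suc j)

col row : ∀ {n} → Variable n → Fin n
col = proj₁
row (_ , i) = inject! i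

z : ∀ {n} (i j : Fin n) → i Fin.≤ j → Variable n
z i j i≤j = j , fromℕ< (s≤s i≤j)

-- A monomial is given by its exponents.

Monomial : ℕ → Set
Monomial n = Variable n → ℕ

infix 4 _≗?_

_≗?_ : ∀ {n} (m m′ : Monomial n) → Dec (m ≗ m′)
m ≗? m′ = map′ uncurry curry
  (Fin.all? λ j → Fin.all? λ i → m (j , i) ℕ.≟ m′ (j , i))

module PsdStability (R : CompleteOrderedField) where

  open CompleteOrderedField R renaming (Carrier to ℝ)
  open MonoidSum +-monoid using (sum)

  infix 5 _+i_

  record ℂ : Set where
    constructor _+i_
    field
      re im : ℝ

  open ℂ public

  ℂ-rawRing : RawRing 0ℓ 0ℓ
  ℂ-rawRing = record
    { Carrier = ℂ
    ; _≈_     = λ w u → re w ≈ re u × im w ≈ im u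
    ; _+_     = λ w u → re w + re u +i im w + im u
    ; _*_     = λ w u → re w * re u - im w * im u +i re w * im u + im w * re u
    ; -_      = λ w → - re w +i - im w
    ; 0#      = 0# +i 0#
    ; 1#      = 1# +i 0#
    }

  module ℂ-ring where
    open RawRing ℂ-rawRing public
    open RawSemiringDefs rawSemiring public using (_^_; product)

  -- A polynomial is presented by a finite list of terms, in which a monomial
  -- may be repeated and a listed coefficient may be zero; as an element of ℂ[Z]
  -- it is determined by `coeff`.

  Polynomial : ℕ → Set
  Polynomial n = List (ℂ × Monomial n)

  coeff : ∀ {n} → Polynomial n → Monomial n → ℂ
  coeff []             m = ℂ-ring.0#
  coeff ((c , m′) ∷ f) m =
    (if does (m′ ≗? m) then c else ℂ-ring.0#) ℂ-ring.+ coeff f m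

  evalMonomial : ∀ {n} → Monomial n → Matrix ℂ n → ℂ
  evalMonomial m M =
    product λ j → product λ i → let v = j , i in M (row v) (col v) ^ m v
    where open ℂ-ring

  eval : ∀ {n} → Polynomial n → Matrix ℂ n → ℂ
  eval []            M = ℂ-ring.0#
  eval ((c , m) ∷ f) M = c ℂ-ring.* evalMonomial m M ℂ-ring.+ eval f M

  Occurs : ∀ {n} → Variable n → Polynomial n → Set
  Occurs v f = ∃ λ m → ¬ (coeff f m ℂ-ring.≈ ℂ-ring.0#) × 0 ℕ.< m v

  Symmetric : ∀ {n} → Matrix ℂ n → Set
  Symmetric M = ∀ i j → M i j ℂ-ring.≈ M j i

  Im : ∀ {n} → Matrix ℂ n → Matrix ℝ n
  Im M i j = im (M i j)

  -- Only applied to symmetric matrices.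

  PositiveDefinite : ∀ {n} → Matrix ℝ n → Set
  PositiveDefinite {n} A = (x : Fin n → ℝ) → ¬ (∀ i → x i ≈ 0#) →
    0# < sum λ i → sum λ j → x i * A i j * x j

  PsdStable : ∀ {n} → Polynomial n → Set
  PsdStable f = ∀ M → Symmetric M → PositiveDefinite (Im M) →
    ¬ (eval f M ℂ-ring.≈ ℂ-ring.0#)

{-# OPTIONS --safe #-}

-- Suppose z k k does not occur in f.  Since the (k, k) entry of Im M can be made
-- as large as we please without changing f(M), the entry w at (k, l) may be any
-- complex number, so f, as a polynomial in w alone, has no zeros and is constant
-- by the fundamental theorem of algebra.  If z k l occurred, the remaining
-- entries (positive imaginary on the diagonal, real off it) could be chosen so
-- that this polynomial is not constant.
--
-- For 2 × 2 matrices the statement contains the fundamental theorem of algebra.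
-- It is proved here by d'Alembert's argument: |p|² attains its infimum by
-- compactness (Cousin's lemma, used once for each coordinate), and where p is
-- nonzero |p|² decreases in the direction that turns the lowest nonconstant term
-- of p against p.

module Submission where

open import Defs
open import Algebra.Bundles using (CommutativeRing)
import Algebra.Properties.AbelianGroup as AbelianGroupProperties
import Algebra.Properties.Ring as RingProperties
import Algebra.Properties.Semiring.Mult.TCOptimised as Mult
import Algebra.Solver.Ring as RingSolver
open import Algebra.Solver.Ring.AlmostCommutativeRing using (_-Raw-AlmostCommutative⟶_; fromCommutativeRing)
open import Data.Bool.Base using (if_then_else_)
open import Data.Empty using (⊥; ⊥-elim)
open import Data.Fin.Base as Fin using (Fin; inject!; suc; toℕ; zero)
import Data.Fin.Properties as Fin
open import Data.Integer.Base as ℤ using (+_; -[1+_]; _⊖_; ℤ)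
import Data.Integer.Properties as ℤ
open import Data.List.Base using (List; []; _++_; _∷_; concat; tabulate)
open import Data.List.Membership.Propositional using (_∈_)
open import Data.List.Membership.Propositional.Properties using (∈-concat⁺′; ∈-tabulate⁺; ∈-tabulate⁻; ∈-∃++)
open import Data.List.Relation.Binary.Permutation.Propositional as ↭ using (_↭_; ↭-trans; ↭⇒↭ₛ)
open import Data.List.Relation.Binary.Permutation.Propositional.Properties using (shift; ∈-resp-↭)
open import Data.List.Relation.Binary.Permutation.Setoid.Properties using (Unique-resp-↭)
open import Data.List.Relation.Unary.All as All using (All; []; _∷_)
import Data.List.Relation.Unary.All.Properties as All
open import Data.List.Relation.Unary.AllPairs using ([]; _∷_)
import Data.List.Relation.Unary.AllPairs.Properties as AllPairs
open import Data.List.Relation.Unary.Any as Any using (Any; any?; here; there)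
open import Data.List.Relation.Unary.Unique.Propositional using (Unique)
import Data.List.Relation.Unary.Unique.Propositional.Properties as Unique
open import Data.Maybe.Base as Maybe using (Maybe)
open import Data.Nat.Base as ℕ using (suc; s≤s; zero; ℕ)
open import Data.Nat.Induction using (<-rec)
import Data.Nat.Properties as ℕ
open import Data.Nat.Solver using (module +-*-Solver)
open import Data.Product.Base using (_,_; _×_; proj₁; proj₂; ∃)
open import Data.Product.Properties using (≡-dec)
open import Data.Sum.Base using ([_,_]′; _⊎_; inj₁; inj₂)
open import Function.Base using (_∘_; const)
open import Level using (0ℓ)
import Relation.Binary.Construct.StrictToNonStrict as NonStrict
open import Relation.Binary.Definitions using (DecidableEquality; tri<; tri>; tri≈)
open import Relation.Binary.PropositionalEquality.Core as ≡ using (_≗_; _≡_; _≢_)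
import Relation.Binary.PropositionalEquality.Properties as ≡
import Relation.Binary.Reasoning.Setoid as SetoidReasoning
open import Relation.Binary.Structures using (IsStrictTotalOrder)
open import Relation.Nullary.Decidable.Core using (Dec; _×-dec_; decidable-stable; dec⇒maybe; does; map′; no; yes; ¬?)
open import Relation.Nullary.Negation.Core using (contradiction; ¬_; ¬¬-map)
open import Relation.Unary using (Pred)

-- Apart from what the axioms of ℝ supply, the logic is constructive, and this shapes the
-- statements: no minimiser or root is ever exhibited outright. If p had no root, its infimum would
-- be strictly below every value of |p|², and compactness would turn this into a uniform gap, which
-- is absurd. So the fundamental theorem says that p cannot be rootless, and Cousin's lemma carries
-- a double negation. It disappears at the very end because occurrence is decidable: real equality
-- is, by trichotomy, and only listed monomials can have nonzero coefficients. Terms of a listed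
-- polynomial may cancel, so a variable that does not occur can still be visible in the list.
-- Statements about dropping or choosing variables therefore concern weighted sums over the whole
-- list, never single terms. The root w is found before the (k, k) entry is fixed, because that
-- entry has to outweigh the imaginary part of w. Turning the lowest term against p would ordinarily
-- use arguments of complex numbers; square roots and fourth roots of unity replace them.

-- The ring solvers of the standard library need coefficients with a decision
-- procedure that computes, which the equality of an abstract ring is not.

module IntegerSolver {c ℓ} (R : CommutativeRing c ℓ) where
  open CommutativeRing R
  open Mult semiring using (1+×; ×-homo-+; ×1-homo-*) renaming (_×_ to _×ℕ_)
  open RingProperties ring using (-‿distribˡ-*)
  open AbelianGroupProperties +-abelianGroup using (⁻¹-∙-comm; ε⁻¹≈ε; ⁻¹-involutive)
  open import Relation.Binary.Reasoning.Setoid setoid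

  ⟦_⟧ : ℤ → Carrier
  ⟦ + n      ⟧ = n ×ℕ 1#
  ⟦ -[1+ n ] ⟧ = - (suc n ×ℕ 1#)

  -‿homo : ∀ i → ⟦ ℤ.- i ⟧ ≈ - ⟦ i ⟧
  -‿homo (+ zero)  = sym ε⁻¹≈ε
  -‿homo (+ suc n) = refl
  -‿homo -[1+ n ]  = sym (⁻¹-involutive _)

  ⊖-homo : ∀ m n → ⟦ m ⊖ n ⟧ ≈ m ×ℕ 1# - n ×ℕ 1#
  ⊖-homo m       zero    = sym (trans (+-congˡ ε⁻¹≈ε) (+-identityʳ _))
  ⊖-homo zero    (suc n) = sym (+-identityˡ _)
  ⊖-homo (suc m) (suc n) = begin
    ⟦ suc m ⊖ suc n ⟧                          ≡⟨ ≡.cong ⟦_⟧ (ℤ.[1+m]⊖[1+n]≡m⊖n m n) ⟩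
    ⟦ m ⊖ n ⟧                                  ≈⟨ ⊖-homo m n ⟩
    m′ - n′                                    ≈⟨ +-congʳ (+-identityˡ m′) ⟨
    0# + m′ - n′                               ≈⟨ +-congʳ (+-congʳ (-‿inverseʳ 1#)) ⟨
    1# - 1# + m′ - n′                          ≈⟨ +-congʳ (trans (+-assoc _ _ _) (trans (+-congˡ (+-comm _ _)) (sym (+-assoc _ _ _)))) ⟩
    1# + m′ - 1# - n′                          ≈⟨ +-assoc _ _ _ ⟩
    1# + m′ + (- 1# - n′)                      ≈⟨ +-congˡ (⁻¹-∙-comm 1# n′) ⟩
    1# + m′ - (1# + n′)                        ≈⟨ +-cong (1+× m 1#) (-‿cong (1+× n 1#)) ⟨
    suc m ×ℕ 1# - suc n ×ℕ 1#                  ∎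
    where
    m′ = m ×ℕ 1#
    n′ = n ×ℕ 1#

  +-homo : ∀ i j → ⟦ i ℤ.+ j ⟧ ≈ ⟦ i ⟧ + ⟦ j ⟧
  +-homo (+ m)    (+ n)    = ×-homo-+ 1# m n
  +-homo (+ m)    -[1+ n ] = ⊖-homo m (suc n)
  +-homo -[1+ m ] (+ n)    = trans (⊖-homo n (suc m)) (+-comm _ _)
  +-homo -[1+ m ] -[1+ n ] = begin
    - (suc (suc (m ℕ.+ n)) ×ℕ 1#)      ≡⟨ ≡.cong (λ k → - (suc k ×ℕ 1#)) (ℕ.+-suc m n) ⟨
    - ((suc m ℕ.+ suc n) ×ℕ 1#)        ≈⟨ -‿cong (×-homo-+ 1# (suc m) (suc n)) ⟩
    - (suc m ×ℕ 1# + suc n ×ℕ 1#)      ≈⟨ ⁻¹-∙-comm _ _ ⟨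
    - (suc m ×ℕ 1#) - suc n ×ℕ 1#      ∎

  +*-homo : ∀ m j → ⟦ + m ℤ.* j ⟧ ≈ ⟦ + m ⟧ * ⟦ j ⟧
  +*-homo m (+ n)    = trans (reflexive (≡.cong ⟦_⟧ (≡.sym (ℤ.pos-* m n)))) (×1-homo-* m n)
  +*-homo m -[1+ n ] = begin
    ⟦ + m ℤ.* ℤ.- (+ suc n) ⟧       ≡⟨ ≡.cong ⟦_⟧ (ℤ.neg-distribʳ-* (+ m) (+ suc n)) ⟨
    ⟦ ℤ.- (+ m ℤ.* + suc n) ⟧       ≈⟨ -‿homo (+ m ℤ.* + suc n) ⟩
    - ⟦ + m ℤ.* + suc n ⟧           ≈⟨ -‿cong (+*-homo m (+ suc n)) ⟩
    - (⟦ + m ⟧ * ⟦ + suc n ⟧)       ≈⟨ RingProperties.-‿distribʳ-* ring _ _ ⟩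
    ⟦ + m ⟧ * - ⟦ + suc n ⟧         ∎

  *-homo : ∀ i j → ⟦ i ℤ.* j ⟧ ≈ ⟦ i ⟧ * ⟦ j ⟧
  *-homo (+ m)    j = +*-homo m j
  *-homo -[1+ m ] j = begin
    ⟦ ℤ.- (+ suc m) ℤ.* j ⟧         ≡⟨ ≡.cong ⟦_⟧ (ℤ.neg-distribˡ-* (+ suc m) j) ⟨
    ⟦ ℤ.- (+ suc m ℤ.* j) ⟧         ≈⟨ -‿homo (+ suc m ℤ.* j) ⟩
    - ⟦ + suc m ℤ.* j ⟧             ≈⟨ -‿cong (+*-homo (suc m) j) ⟩
    - (⟦ + suc m ⟧ * ⟦ j ⟧)         ≈⟨ -‿distribˡ-* _ _ ⟩
    - ⟦ + suc m ⟧ * ⟦ j ⟧           ∎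

  homomorphism : ℤ.+-*-rawRing -Raw-AlmostCommutative⟶ fromCommutativeRing R
  homomorphism = record
    { ⟦_⟧ = ⟦_⟧ ; +-homo = +-homo ; *-homo = *-homo ; -‿homo = -‿homo
    ; 0-homo = refl ; 1-homo = refl }

  coefficient≟ : ∀ i j → Maybe (⟦ i ⟧ ≈ ⟦ j ⟧)
  coefficient≟ i j = Maybe.map (λ { ≡.refl → refl }) (dec⇒maybe (i ℤ.≟ j))

  open RingSolver ℤ.+-*-rawRing (fromCommutativeRing R) homomorphism coefficient≟ public
    using (solve; con; _:+_; _:*_; _:-_; :-_; _:=_; _:^_)

-- Univariate polynomials in Horner form.

module Univariate (K : CommutativeRing 0ℓ 0ℓ) where
  open CommutativeRing K

  -- The coefficients are a 0, …, a (D - 1).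

  poly : (ℕ → Carrier) → ℕ → Carrier → Carrier
  poly a zero    z = 0#
  poly a (suc D) z = a 0 + z * poly (a ∘ suc) D z

  -- Trailing zeros are allowed, so D only bounds the number of coefficients and no leading
  -- coefficient has to be tracked.
  Nonzero AllZero : (ℕ → Carrier) → ℕ → Set
  Nonzero a D = ∃ λ d → d ℕ.< D × ¬ (a d ≈ 0#)
  AllZero a D = ∀ {d} → d ℕ.< D → a d ≈ 0#

  nonzero-suc : ∀ {a D} → Nonzero (a ∘ suc) D → Nonzero a (suc D)
  nonzero-suc (d , d<D , a≉0) = suc d , ℕ.s<s d<D , a≉0

  poly-congʳ : ∀ a D {z w} → z ≈ w → poly a D z ≈ poly a D w
  poly-congʳ a zero    z≈w = refl
  poly-congʳ a (suc D) z≈w = +-congˡ (*-cong z≈w (poly-congʳ (a ∘ suc) D z≈w))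

  poly-zero : ∀ a D z → AllZero a D → poly a D z ≈ 0#
  poly-zero a zero    z zeros = refl
  poly-zero a (suc D) z zeros = trans
    (+-cong (zeros ℕ.z<s) (trans (*-congˡ (poly-zero (a ∘ suc) D z (zeros ∘ ℕ.s<s))) (zeroʳ z)))
    (+-identityˡ 0#)

  poly-constant : ∀ a D z → AllZero (a ∘ suc) D → poly a (suc D) z ≈ a 0
  poly-constant a D z zeros = trans
    (+-congˡ (trans (*-congˡ (poly-zero (a ∘ suc) D z zeros)) (zeroʳ z))) (+-identityʳ _)

-- Sums over lists of terms, and their expansion in one variable.

module Multivariate (K : CommutativeRing 0ℓ 0ℓ) (V : Set) where
  open CommutativeRing K
  open import Algebra.Properties.Semiring.Exp semiring using (_^_; ^-congˡ)
  open IntegerSolver K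
  open Univariate K

  -- Recursion on both arguments makes `δ (suc e) ∘ suc` compute to `δ e`, so that `δ e` serves
  -- directly as the coefficient sequence of `z ^ e`.
  δ : ℕ → ℕ → Carrier
  δ zero    zero    = 1#
  δ zero    (suc _) = 0#
  δ (suc _) zero    = 0#
  δ (suc m) (suc n) = δ m n

  δ-diagonal : ∀ m → δ m m ≈ 1#
  δ-diagonal zero    = refl
  δ-diagonal (suc m) = δ-diagonal m

  δ-off-diagonal : ∀ m n → m ≢ n → δ m n ≈ 0#
  δ-off-diagonal zero    zero    m≢n = ⊥-elim (m≢n ≡.refl)
  δ-off-diagonal zero    (suc n) m≢n = refl
  δ-off-diagonal (suc m) zero    m≢n = refl
  δ-off-diagonal (suc m) (suc n) m≢n = δ-off-diagonal m n (m≢n ∘ ≡.cong suc)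

  ^≈poly-δ : ∀ {e D} z → e ℕ.< D → z ^ e ≈ poly (δ e) D z
  ^≈poly-δ {zero}  {suc D} z e<D         = sym (poly-constant (δ 0) D z (λ _ → refl))
  ^≈poly-δ {suc e} {suc D} z (ℕ.s<s e<D) =
    trans (*-congˡ (^≈poly-δ z e<D)) (sym (+-identityˡ _))

  Terms : Set
  Terms = List (Carrier × (V → ℕ))

  -- Both evaluation and the extraction of a coefficient are of this form, with
  -- φ = monomial vs x and φ = indicator vs m₀.

  ∑ : Terms → ((V → ℕ) → Carrier) → Carrier
  ∑ []            φ = 0#
  ∑ ((c , m) ∷ f) φ = c * φ m + ∑ f φ

  ∑-cong-All : ∀ {f φ ψ} → All (λ (_ , m) → φ m ≈ ψ m) f → ∑ f φ ≈ ∑ f ψ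
  ∑-cong-All []         = refl
  ∑-cong-All (eq ∷ eqs) = +-cong (*-congˡ eq) (∑-cong-All eqs)

  ∑-cong : ∀ f {φ ψ} → (∀ m → φ m ≈ ψ m) → ∑ f φ ≈ ∑ f ψ
  ∑-cong f eq = ∑-cong-All (All.universal (λ (_ , m) → eq m) f)

  ∑-0 : ∀ f → ∑ f (λ _ → 0#) ≈ 0#
  ∑-0 []            = refl
  ∑-0 ((c , m) ∷ f) = trans (+-cong (zeroʳ c) (∑-0 f)) (+-identityˡ 0#)

  ∑-linear : ∀ f φ z ψ → ∑ f (λ m → φ m + z * ψ m) ≈ ∑ f φ + z * ∑ f ψ
  ∑-linear []            φ z ψ = sym (trans (+-identityˡ _) (zeroʳ z))
  ∑-linear ((c , m) ∷ f) φ z ψ = trans (+-congˡ (∑-linear f φ z ψ))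
    (solve 6 (λ c a b z s t → c :* (a :+ z :* b) :+ (s :+ z :* t) :=
                                c :* a :+ s :+ z :* (c :* b :+ t))
      refl c (φ m) (ψ m) z (∑ f φ) (∑ f ψ))

  *-poly : ∀ y a D z → y * poly a D z ≈ poly (λ d → y * a d) D z
  *-poly y a zero    z = zeroʳ y
  *-poly y a (suc D) z = trans
    (solve 4 (λ y a z p → y :* (a :+ z :* p) := y :* a :+ z :* (y :* p)) refl y (a 0) z _)
    (+-congˡ (*-congˡ (*-poly y (a ∘ suc) D z)))

  ∑-poly : ∀ f (a : (V → ℕ) → ℕ → Carrier) D z → ∑ f (λ m → poly (a m) D z) ≈ poly (λ d → ∑ f (λ m → a m d)) D z
  ∑-poly f a zero    z = ∑-0 f
  ∑-poly f a (suc D) z = trans (∑-linear f (λ m → a m 0) z _)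
    (+-congˡ (*-congˡ (∑-poly f (λ m → a m ∘ suc) D z)))

  -- Sorting terms by their exponent of `v` gives a univariate polynomial: `δ (m v) d` selects
  -- exponent d, and the weight `ψ` carries the contribution of the other variables.
  ∑-power : ∀ f {v D} (ψ : (V → ℕ) → Carrier) z → All (λ (_ , m) → m v ℕ.< D) f →
    ∑ f (λ m → ψ m * z ^ m v) ≈ poly (λ d → ∑ f (λ m → ψ m * δ (m v) d)) D z
  ∑-power f {v} {D} ψ z bound = trans
    (∑-cong-All (All.map (λ {(_ , m)} mv<D → trans (*-congˡ (^≈poly-δ z mv<D)) (*-poly (ψ m) (δ (m v)) D z)) bound))
    (∑-poly f (λ m d → ψ m * δ (m v) d) D z)

  -- The lower bound `d` puts a prescribed exponent within range without searching the list for a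
  -- term that attains it.
  degree-bound : ∀ (f : Terms) v d → ∃ λ D → d ℕ.≤ D × All (λ (_ , m) → m v ℕ.≤ D) f
  degree-bound []            v d = d , ℕ.≤-refl , []
  degree-bound ((c , m) ∷ f) v d =
    let D , d≤D , bound = degree-bound f v d
    in m v ℕ.⊔ D , ℕ.m≤n⇒m≤o⊔n (m v) d≤D , ℕ.m≤m⊔n (m v) D ∷ All.map (ℕ.m≤n⇒m≤o⊔n (m v)) bound

  ∏ : List V → (V → Carrier) → Carrier
  ∏ []       g = 1#
  ∏ (v ∷ vs) g = g v * ∏ vs g

  ∏-cong-All : ∀ {vs g h} → All (λ v → g v ≈ h v) vs → ∏ vs g ≈ ∏ vs h
  ∏-cong-All []         = refl
  ∏-cong-All (eq ∷ eqs) = *-cong eq (∏-cong-All eqs)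

  ∏-↭ : ∀ {vs ws} g → vs ↭ ws → ∏ vs g ≈ ∏ ws g
  ∏-↭ g ↭.refl          = refl
  ∏-↭ g (↭.prep v p)    = *-congˡ (∏-↭ g p)
  ∏-↭ g (↭.swap v w p)  = trans (*-congˡ (*-congˡ (∏-↭ g p)))
    (solve 3 (λ x y z → x :* (y :* z) := y :* (x :* z)) refl (g v) (g w) _)
  ∏-↭ g (↭.trans p q)   = trans (∏-↭ g p) (∏-↭ g q)

  indicator : List V → (V → ℕ) → (V → ℕ) → Carrier
  indicator vs m₀ m = ∏ vs λ v → δ (m v) (m₀ v)

  monomial : List V → (V → Carrier) → (V → ℕ) → Carrier
  monomial vs x m = ∏ vs λ v → x v ^ m v

-- Choosing the values of the variables one at a time.

module Substitution (K : CommutativeRing 0ℓ 0ℓ) {V : Set} (_≟_ : DecidableEquality V) where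
  open CommutativeRing K
  open import Algebra.Properties.Semiring.Exp semiring using (_^_; ^-congˡ)
  open IntegerSolver K
  open Univariate K
  open Multivariate K V

  _[_≔_] : ∀ {A : Set} → (V → A) → V → A → V → A
  (g [ v ≔ a ]) w with w ≟ v
  ... | yes _ = a
  ... | no  _ = g w

  []≔-eq : ∀ {A : Set} (g : V → A) v a → (g [ v ≔ a ]) v ≡ a
  []≔-eq g v a with v ≟ v
  ... | yes _   = ≡.refl
  ... | no  v≢v = ⊥-elim (v≢v ≡.refl)

  []≔-≢ : ∀ {A : Set} (g : V → A) {v} a {w} → w ≢ v → (g [ v ≔ a ]) w ≡ g w
  []≔-≢ g {v} a {w} w≢v with w ≟ v
  ... | yes w≡v = ⊥-elim (w≢v w≡v)
  ... | no  _   = ≡.refl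

  indicator-[]≔ : ∀ {v vs} m₀ d m → All (v ≢_) vs →
    δ (m v) d * indicator vs m₀ m ≈ indicator (v ∷ vs) (m₀ [ v ≔ d ]) m
  indicator-[]≔ {v} m₀ d m v∉vs = *-cong
    (reflexive (≡.cong (δ (m v)) (≡.sym ([]≔-eq m₀ v d))))
    (∏-cong-All (All.map (λ {w} v≢w → reflexive (≡.cong (δ (m w)) (≡.sym ([]≔-≢ m₀ d (v≢w ∘ ≡.sym))))) v∉vs))

  -- Equal monomials may cancel, so the terms cannot be treated singly. In the expansion by powers
  -- of `v`, each coefficient is a sum of the same kind with `δ (m v) d` absorbed into `ψ`, hence
  -- zero by induction.
  ∑-vanishing : ∀ f {vs} → Unique vs → ∀ ψ → (∀ m₀ → ∑ f (λ m → ψ m * indicator vs m₀ m) ≈ 0#) →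
    ∀ x → ∑ f (λ m → ψ m * monomial vs x m) ≈ 0#
  ∑-vanishing f []                ψ zeros x = zeros (const 0)
  ∑-vanishing f {v ∷ vs} (v∉vs ∷ unique) ψ zeros x =
    let D , _ , bound = degree-bound f v 0
    in trans
      (∑-cong f λ m → solve 3 (λ a b c → a :* (b :* c) := a :* c :* b) refl (ψ m) (x v ^ m v) (monomial vs x m))
      (trans (∑-power f {v} (λ m → ψ m * monomial vs x m) (x v) (All.map ℕ.s≤s bound))
        (poly-zero _ (suc D) (x v) λ {d} _ → trans
          (∑-cong f λ m → solve 3 (λ a b c → a :* b :* c := a :* c :* b) refl (ψ m) (monomial vs x m) (δ (m v) d))
          (∑-vanishing f unique (λ m → ψ m * δ (m v) d) (λ m₀ → trans
            (∑-cong f λ m → trans (*-assoc _ _ _) (*-congˡ (indicator-[]≔ m₀ d m v∉vs)))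
            (zeros (m₀ [ v ≔ d ]))) x)))

  module _
    (Value : V → Carrier → Set)
    (avoid : ∀ v a D → Nonzero a D → ∃ λ z → Value v z × ¬ (poly a D z ≈ 0#))
    -- Admissible defaults for the variables outside the list.
    {x₀ : V → Carrier} (value₀ : ∀ v → Value v (x₀ v))
    where

    -- Once the later variables have values, the sum is a polynomial in `v` whose coefficient at
    -- `m₀ v` is nonzero by induction, so `avoid` supplies a value for `v`.
    ∑-nonvanishing : ∀ f {vs} → Unique vs → ∀ ψ m₀ →
      ¬ (∑ f (λ m → ψ m * indicator vs m₀ m) ≈ 0#) →
      ∃ λ x → (∀ v → Value v (x v)) × ¬ (∑ f (λ m → ψ m * monomial vs x m) ≈ 0#)
    ∑-nonvanishing f [] ψ m₀ nz = x₀ , value₀ , nz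
    ∑-nonvanishing f {v ∷ vs} (v∉vs ∷ unique) ψ m₀ nz =
      let x , valid , nz′ = ∑-nonvanishing f unique (λ m → ψ m * δ (m v) (m₀ v)) m₀
            λ ≈0 → nz (trans (∑-cong f λ m → sym (*-assoc _ _ _)) ≈0)
          ψ′ = λ m → ψ m * monomial vs x m
          D , m₀v≤D , bound = degree-bound f v (m₀ v)
          z , zv , nz″ = avoid v (λ d → ∑ f (λ m → ψ′ m * δ (m v) d)) (suc D) (m₀ v , ℕ.s≤s m₀v≤D , λ ≈0 → nz′ (trans
            (∑-cong f λ m → solve 3 (λ a b c → a :* b :* c := a :* c :* b) refl (ψ m) (δ (m v) (m₀ v)) (monomial vs x m)) ≈0))
      in x [ v ≔ z ] , []≔-valid x z valid zv , λ ≈0 → nz″ (trans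
           (sym (∑-power f ψ′ z (All.map ℕ.s≤s bound)))
           (trans (∑-cong f (extend x z)) ≈0))
      where
      []≔-valid : ∀ x z → (∀ v → Value v (x v)) → Value v z → ∀ w → Value w ((x [ v ≔ z ]) w)
      []≔-valid x z valid zv w with w ≟ v
      ... | yes ≡.refl = zv
      ... | no  _      = valid w
      extend : ∀ x z m → ψ m * monomial vs x m * z ^ m v ≈ ψ m * monomial (v ∷ vs) (x [ v ≔ z ]) m
      extend x z m = trans
        (solve 3 (λ a b c → a :* b :* c := a :* (c :* b)) refl (ψ m) (monomial vs x m) (z ^ m v))
        (*-congˡ (*-cong
          (reflexive (≡.cong (_^ m v) (≡.sym ([]≔-eq x v z))))
          (∏-cong-All (All.map (λ {w} v≢w → reflexive
            (≡.cong (_^ m w) (≡.sym ([]≔-≢ x z (v≢w ∘ ≡.sym))))) v∉vs))))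

    -- The factor δ (m b) 0 keeps only the terms without b; the others cancel,
    -- whatever the value of b.

    root-independent-of : (∀ a D → Nonzero (a ∘ suc) D → ¬ (∀ z → ¬ (poly a (suc D) z ≈ 0#))) →
      ∀ f {a b us} → Unique (a ∷ b ∷ us) →
      (∀ m → 0 ℕ.< m b → ∑ f (indicator (a ∷ b ∷ us) m) ≈ 0#) →
      ∀ m₀ → 0 ℕ.< m₀ a → ¬ (∑ f (indicator (a ∷ b ∷ us) m₀) ≈ 0#) →
      ¬ ¬ ∃ λ x → (∀ v → v ≢ a → Value v (x v)) ×
        (∀ y → ∑ f (monomial (a ∷ b ∷ us) (x [ b ≔ y ])) ≈ 0#)
    root-independent-of root f {a} {b} {us} (a∉ ∷ b∉us ∷ unique) absent m₀ 0<m₀a nz =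
      -- By `absent`, `m₀` does not involve `b`; its exponent of `a` is a successor, so the nonzero
      -- coefficient lies above the constant term.
      go (ℕ.pred (m₀ a)) (≡.sym (ℕ.suc-pred (m₀ a) {{ℕ.>-nonZero 0<m₀a}}))
         (ℕ.n≤0⇒n≡0 (ℕ.≮⇒≥ λ 0<m₀b → nz (absent m₀ 0<m₀b)))
      where
      a≢b : a ≢ b
      a≢b = All.head a∉
      []≔-valid : ∀ x w → (∀ v → Value v (x v)) → ∀ v → v ≢ a → Value v ((x [ a ≔ w ]) v)
      []≔-valid x w valid v v≢a = ≡.subst (Value v) (≡.sym ([]≔-≢ x w v≢a)) (valid v)
      higher : ∀ x {d} → ∑ f (λ m → x a ^ m a * monomial us x m * δ (m b) (suc d)) ≈ 0#
      higher x {d} = trans (∑-cong f λ m → *-comm _ _)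
        (∑-vanishing f {a ∷ us} (All.tail a∉ ∷ unique) (λ m → δ (m b) (suc d)) (λ m′ → trans
          (∑-cong f λ m → trans (indicator-[]≔ {b} {a ∷ us} m′ (suc d) m ((a≢b ∘ ≡.sym) ∷ b∉us))
            (solve 3 (λ a b c → b :* (a :* c) := a :* (b :* c)) refl _ _ _))
          (absent (m′ [ b ≔ suc d ]) (≡.subst (0 ℕ.<_) (≡.sym ([]≔-eq m′ b (suc d))) ℕ.z<s))) x)
      reduce : ∀ x → ∑ f (monomial (a ∷ b ∷ us) x) ≈ ∑ f (λ m → x a ^ m a * monomial us x m * δ (m b) 0)
      reduce x =
        let D , _ , bound = degree-bound f b 0
        in trans (∑-cong f λ m → solve 3 (λ a b c → a :* (b :* c) := a :* c :* b) refl
               (x a ^ m a) (x b ^ m b) (monomial us x m))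
             (trans (∑-power f (λ m → x a ^ m a * monomial us x m) (x b) (All.map ℕ.s≤s bound))
               (poly-constant (λ d → ∑ f (λ m → x a ^ m a * monomial us x m * δ (m b) d)) D (x b) (λ _ → higher x)))
      rearrange : ∀ x w y m → let x′ = x [ a ≔ w ] [ b ≔ y ] in
        x′ a ^ m a * monomial us x′ m * δ (m b) 0 ≈ δ (m b) 0 * monomial us x m * w ^ m a
      rearrange x w y m = trans
        (*-congʳ (*-cong
          (reflexive (≡.cong (_^ m a) (≡.trans ([]≔-≢ (x [ a ≔ w ]) y a≢b) ([]≔-eq x a w))))
          (∏-cong-All (All.zipWith (λ {v} (a≢v , b≢v) → reflexive (≡.cong (_^ m v)
            (≡.trans ([]≔-≢ (x [ a ≔ w ]) y (b≢v ∘ ≡.sym)) ([]≔-≢ x w (a≢v ∘ ≡.sym))))) (All.tail a∉ , b∉us)))))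
        (solve 3 (λ a b c → a :* b :* c := c :* b :* a) refl (w ^ m a) (monomial us x m) (δ (m b) 0))
      go : ∀ e → m₀ a ≡ suc e → m₀ b ≡ 0 →
        ¬ ¬ ∃ λ x → (∀ v → v ≢ a → Value v (x v)) × (∀ y → ∑ f (monomial (a ∷ b ∷ us) (x [ b ≔ y ])) ≈ 0#)
      go e m₀a≡ m₀b≡ =
        -- Both `a` and `b` are left out here: the remaining values are chosen to keep the
        -- coefficient of the power `suc e` of `a` nonzero, and only then is `a` solved for.
        let x , valid , nz′ = ∑-nonvanishing f unique (λ m → δ (m b) 0 * δ (m a) (suc e)) m₀ λ ≈0 →
              nz (trans (∑-cong f λ m → trans
                (*-cong (reflexive (≡.cong (δ (m a)) m₀a≡)) (*-congʳ (reflexive (≡.cong (δ (m b)) m₀b≡))))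
                (solve 3 (λ a b c → a :* (b :* c) := b :* a :* c) refl (δ (m a) (suc e)) (δ (m b) 0) (indicator us m₀ m))) ≈0)
            D , e<D , bound = degree-bound f a (suc e)
            c≉0 = λ ≈0 → nz′ (trans (∑-cong f λ m →
              solve 3 (λ a b c → a :* b :* c := a :* c :* b) refl (δ (m b) 0) (δ (m a) (suc e)) (monomial us x m)) ≈0)
        in λ k → root (λ d → ∑ f (λ m → δ (m b) 0 * monomial us x m * δ (m a) d)) D (e , e<D , c≉0) λ w pw≈0 →
             k (x [ a ≔ w ] , []≔-valid x w valid , λ y → trans (reduce (x [ a ≔ w ] [ b ≔ y ]))
               (trans (∑-cong f (rearrange x w y))
                 (trans (∑-power f (λ m → δ (m b) 0 * monomial us x m) w (All.map ℕ.s≤s bound)) pw≈0)))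

-- Order, small quantities and square roots in ℝ.

module OrderedField (R : CompleteOrderedField) where

  open CompleteOrderedField R renaming (Carrier to ℝ)
  open IntegerSolver commutativeRing
  private module < = IsStrictTotalOrder isStrictTotalOrder

  infix 4 _≟_
  _≟_ : ∀ x y → Dec (x ≈ y)
  _≟_ = <._≟_

  2# : ℝ
  2# = 1# + 1#

  abstract

    ≤-refl : ∀ {x} → x ≤ x
    ≤-refl = inj₂ refl

    ≤-reflexive : ∀ {x y} → x ≈ y → x ≤ y
    ≤-reflexive = inj₂

    <⇒≤ : ∀ {x y} → x < y → x ≤ y
    <⇒≤ = inj₁

    ≤-trans : ∀ {x y z} → x ≤ y → y ≤ z → x ≤ z
    ≤-trans = NonStrict.trans _≈_ _<_ isEquivalence <.<-resp-≈ <.trans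

    <-≤-trans : ∀ {x y z} → x < y → y ≤ z → x < z
    <-≤-trans = NonStrict.<-≤-trans _≈_ _<_ <.trans <.<-respʳ-≈

    ≤-<-trans : ∀ {x y z} → x ≤ y → y < z → x < z
    ≤-<-trans = NonStrict.≤-<-trans _≈_ _<_ sym <.trans <.<-respˡ-≈

    <-irrefl : ∀ {x} → ¬ (x < x)
    <-irrefl = <.irrefl refl

    <-respʳ : ∀ {x y z} → y ≈ z → x < y → x < z
    <-respʳ = <.<-respʳ-≈

    <-respˡ : ∀ {x y z} → y ≈ z → y < x → z < x
    <-respˡ = <.<-respˡ-≈

    ≤-<-connex : ∀ x y → x ≤ y ⊎ y < x
    ≤-<-connex x y with <.compare x y
    ... | tri< x<y _ _ = inj₁ (inj₁ x<y)
    ... | tri≈ _ x≈y _ = inj₁ (inj₂ x≈y)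
    ... | tri> _ _ y<x = inj₂ y<x

    ≮⇒≥ : ∀ {x y} → ¬ (x < y) → y ≤ x
    ≮⇒≥ {x} {y} x≮y with ≤-<-connex y x
    ... | inj₁ y≤x = y≤x
    ... | inj₂ x<y = ⊥-elim (x≮y x<y)

    ≤⇒≯ : ∀ {x y} → x ≤ y → ¬ (y < x)
    ≤⇒≯ x≤y y<x = <-irrefl (≤-<-trans x≤y y<x)

    ≤-antisym : ∀ {x y} → x ≤ y → y ≤ x → x ≈ y
    ≤-antisym = NonStrict.antisym _≈_ _<_ isEquivalence <.trans <.irrefl

    -- With `solve`, these turn order goals into certificates: exhibit the
    -- difference of the two sides as a sum of products of nonnegative terms.

    ≤-from : ∀ {x y s} → 0# ≤ s → x + s ≈ y → x ≤ y
    ≤-from {x} {y} (inj₁ 0<s) eq = inj₁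
      (<-respˡ (+-identityˡ x) (<-respʳ (trans (+-comm _ x) eq) (+-monoˡ-< x 0<s)))
    ≤-from {x} {y} (inj₂ 0≈s) eq = inj₂ (trans (sym (+-identityʳ x)) (trans (+-congˡ 0≈s) eq))

    <-from : ∀ {x y s} → 0# < s → x + s ≈ y → x < y
    <-from {x} 0<s eq = <-respˡ (+-identityˡ x) (<-respʳ (trans (+-comm _ x) eq) (+-monoˡ-< x 0<s))

    <-diff : ∀ {x y} → x < y → 0# < y - x
    <-diff {x} x<y = <-respˡ (-‿inverseʳ x) (+-monoˡ-< (- x) x<y)

    ≤-diff : ∀ {x y} → x ≤ y → 0# ≤ y - x
    ≤-diff     (inj₁ x<y) = inj₁ (<-diff x<y)
    ≤-diff {x} (inj₂ x≈y) = inj₂ (trans (sym (-‿inverseʳ x)) (+-congʳ x≈y))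

    pos+nonneg : ∀ {x y} → 0# < x → 0# ≤ y → 0# < x + y
    pos+nonneg {x} {y} 0<x 0≤y =
      <-≤-trans 0<x (≤-from 0≤y refl)

    nonneg+pos : ∀ {x y} → 0# ≤ x → 0# < y → 0# < x + y
    nonneg+pos 0≤x 0<y = <-respʳ (+-comm _ _) (pos+nonneg 0<y 0≤x)

    +-nonneg : ∀ {x y} → 0# ≤ x → 0# ≤ y → 0# ≤ x + y
    +-nonneg 0≤x 0≤y = ≤-trans 0≤x (≤-from 0≤y refl)

    *-nonneg : ∀ {x y} → 0# ≤ x → 0# ≤ y → 0# ≤ x * y
    *-nonneg (inj₁ 0<x) (inj₁ 0<y) = inj₁ (*-pos 0<x 0<y)
    *-nonneg {x} {y} (inj₂ 0≈x) _  = inj₂ (trans (sym (zeroˡ y)) (*-congʳ 0≈x))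
    *-nonneg {x} {y} _ (inj₂ 0≈y)  = inj₂ (trans (sym (zeroʳ x)) (*-congˡ 0≈y))

    neg⇒pos : ∀ {x} → x < 0# → 0# < - x
    neg⇒pos {x} x<0 = <-respʳ (+-identityˡ (- x)) (<-diff x<0)

    ≉0⇒0<x*x : ∀ {x} → ¬ (x ≈ 0#) → 0# < x * x
    ≉0⇒0<x*x {x} x≉0 with <.compare x 0#
    ... | tri< x<0 _ _ = <-respʳ (solve 1 (λ x → :- x :* :- x := x :* x) refl x)
                           (*-pos (neg⇒pos x<0) (neg⇒pos x<0))
    ... | tri≈ _ x≈0 _ = ⊥-elim (x≉0 x≈0)
    ... | tri> _ _ 0<x = *-pos 0<x 0<x

    0≤x*x : ∀ x → 0# ≤ x * x
    0≤x*x x with x ≟ 0#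
    ... | yes x≈0 = inj₂ (sym (trans (*-congʳ x≈0) (zeroˡ x)))
    ... | no  x≉0 = inj₁ (≉0⇒0<x*x x≉0)

    0<1 : 0# < 1#
    0<1 = <-respʳ (*-identityˡ 1#) (≉0⇒0<x*x 1≉0)

    0≤1 : 0# ≤ 1#
    0≤1 = <⇒≤ 0<1

    0<2 : 0# < 2#
    0<2 = pos+nonneg 0<1 0≤1

    0<⇒≉0 : ∀ {x} → 0# < x → ¬ (x ≈ 0#)
    0<⇒≉0 0<x x≈0 = <.irrefl (sym x≈0) 0<x

    pos-cancelˡ : ∀ {x y} → 0# ≤ x → 0# < x * y → 0# < y
    pos-cancelˡ {x} {y} 0≤x 0<xy with ≤-<-connex y 0#
    ... | inj₂ 0<y = 0<y
    ... | inj₁ y≤0 = ⊥-elim (≤⇒≯ (*-nonneg 0≤x (≤-diff y≤0))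
                       (<-from 0<xy (solve 2 (λ x y → x :* (con (+ 0) :- y) :+ x :* y := con (+ 0)) refl x y)))

    inverse-pos : ∀ {x} → 0# < x → ∃ λ y → 0# < y × x * y ≈ 1#
    inverse-pos {x} 0<x =
      let y , xy≈1 = inverse x (0<⇒≉0 0<x)
      in y , pos-cancelˡ (<⇒≤ 0<x) (<-respʳ (sym xy≈1) 0<1) , xy≈1

    *-pos-cancelˡ-≤ : ∀ {x y z} → 0# < x → x * y ≤ x * z → y ≤ z
    *-pos-cancelˡ-≤ {x} {y} {z} 0<x xy≤xz = ≮⇒≥ λ z<y → ≤⇒≯ xy≤xz
      (<-from (*-pos 0<x (<-diff z<y)) (solve 3 (λ x y z → x :* z :+ x :* (y :- z) := x :* y) refl x y z))

    x*x≤y*y⇒x≤y : ∀ {x y} → 0# ≤ y → x * x ≤ y * y → x ≤ y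
    x*x≤y*y⇒x≤y {x} {y} 0≤y xx≤yy = ≮⇒≥ λ y<x → ≤⇒≯ xx≤yy
      (<-from (*-pos (<-diff y<x) (<-≤-trans (nonneg+pos (+-nonneg 0≤y 0≤y) (<-diff y<x)) ≤-refl))
        (solve 2 (λ x y → y :* y :+ (x :- y) :* (y :+ y :+ (x :- y)) := x :* x) refl x y))

    x≤y⇒x*x≤y*y : ∀ {x y} → 0# ≤ x → x ≤ y → x * x ≤ y * y
    x≤y⇒x*x≤y*y {x} {y} 0≤x x≤y =
      ≤-from (*-nonneg (≤-diff x≤y) (+-nonneg (+-nonneg 0≤x 0≤x) (≤-diff x≤y)))
        (solve 2 (λ x y → x :* x :+ (y :- x) :* (x :+ x :+ (y :- x)) := y :* y) refl x y)

    lower : ∀ {x y} → 0# < x → 0# < y → ∃ λ z → 0# < z × z ≤ x × z ≤ y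
    lower {x} {y} 0<x 0<y with ≤-<-connex x y
    ... | inj₁ x≤y = x , 0<x , ≤-refl , x≤y
    ... | inj₂ y<x = y , 0<y , <⇒≤ y<x , ≤-refl

    upper : ∀ x y → ∃ λ z → x ≤ z × y ≤ z
    upper x y with ≤-<-connex x y
    ... | inj₁ x≤y = y , x≤y , ≤-refl
    ... | inj₂ y<x = x , ≤-refl , <⇒≤ y<x

    halve : ∀ {x} → 0# < x → ∃ λ h → 0# < h × h + h ≈ x
    halve {x} 0<x with inverse-pos 0<2
    ... | y , 0<y , 2y≈1 = x * y , *-pos 0<x 0<y , trans
      (solve 2 (λ x y → x :* y :+ x :* y := x :* (con (+ 2) :* y)) refl x y)
      (trans (*-congˡ 2y≈1) (*-identityʳ x))

    -- Dividing by a + 1 rather than a covers a = 0; the cap at 1 lets δ² be bounded by δ.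
    *-small : ∀ {a b} → 0# ≤ a → 0# < b →
      ∃ λ δ → 0# < δ × δ ≤ 1# × (∀ {t} → t ≤ δ → a * t ≤ b)
    *-small {a} {b} 0≤a 0<b =
      let e , 0<e , [a+1]e≈1   = inverse-pos (nonneg+pos 0≤a 0<1)
          δ , 0<δ , δ≤1 , δ≤be = lower 0<1 (*-pos 0<b 0<e)
      in δ , 0<δ , δ≤1 , λ {t} t≤δ →
        ≤-from (+-nonneg (*-nonneg 0≤a (≤-diff (≤-trans t≤δ δ≤be))) (<⇒≤ (*-pos 0<b 0<e)))
          (trans (solve 4 (λ a b e t → a :* t :+ (a :* (b :* e :- t) :+ b :* e) := b :* ((a :+ con (+ 1)) :* e)) refl a b e t)
            (trans (*-congˡ [a+1]e≈1) (*-identityʳ b)))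

    sup-approx : ∀ {S s δ} → LeastUpperBound S s → 0# < δ → ¬ (∀ x → S x → x ≤ s - δ)
    sup-approx {S} {s} {δ} (_ , least) 0<δ bound = ≤⇒≯ (least (s - δ) bound)
      (<-from 0<δ (solve 2 (λ s δ → s :- δ :+ δ := s) refl s δ))

  abstract

    supremum² : ∀ {a s} → 0# ≤ a → LeastUpperBound (λ x → x * x ≤ a) s → 0# ≤ s × s * s ≈ a
    supremum² {a} {s} 0≤a isLub = 0≤s , ≤-antisym (≮⇒≥ ss≯a) (≮⇒≥ ss≮a)
      where
      0≤s : 0# ≤ s
      0≤s = proj₁ isLub 0# (≤-trans (≤-reflexive (zeroˡ 0#)) 0≤a)
      ss≮a : ¬ (s * s < a)
      ss≮a ss<a =
        -- As δ ≤ 1, (s + δ)² ≤ s² + (2s + 1)δ ≤ a, so s + δ would still belong to the set.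
        let δ , 0<δ , δ≤1 , small = *-small (+-nonneg (+-nonneg 0≤s 0≤s) 0≤1) (<-diff ss<a)
            sδ≤a = ≤-trans
              (≤-from (*-nonneg (<⇒≤ 0<δ) (≤-diff δ≤1))
                (solve 2 (λ s δ → (s :+ δ) :* (s :+ δ) :+ δ :* (con (+ 1) :- δ) :=
                                  s :* s :+ (s :+ s :+ con (+ 1)) :* δ) refl s δ))
              (≤-from (≤-diff (small ≤-refl))
                (solve 3 (λ s δ a → s :* s :+ (s :+ s :+ con (+ 1)) :* δ :+
                                    (a :- s :* s :- (s :+ s :+ con (+ 1)) :* δ) := a) refl s δ a))
        in ≤⇒≯ (proj₁ isLub (s + δ) sδ≤a) (<-from 0<δ refl)
      ss≯a : ¬ (a < s * s)
      ss≯a a<ss =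
        -- (s - δ)² ≥ s² - 2sδ ≥ a, so s - δ would already be an upper bound; δ ≤ s keeps it
        -- nonnegative, as comparing squares requires.
        let η , 0<η , _ , small   = *-small (+-nonneg 0≤s 0≤s) (<-diff a<ss)
            δ , 0<δ , δ≤η , δ≤s = lower 0<η (pos-cancelˡ 0≤s (≤-<-trans 0≤a a<ss))
        in sup-approx isLub 0<δ λ x xx≤a →
          x*x≤y*y⇒x≤y (≤-diff δ≤s) (≤-trans xx≤a
            (≤-from (+-nonneg (0≤x*x δ) (≤-diff (small δ≤η)))
              (solve 3 (λ s δ a → a :+ (δ :* δ :+ (s :* s :- a :- (s :+ s) :* δ)) := (s :- δ) :* (s :- δ)) refl s δ a)))

    sqrt : ∀ {a} → 0# ≤ a → ∃ λ r → 0# ≤ r × r * r ≈ a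
    sqrt {a} 0≤a = _ , supremum² 0≤a (proj₂ (complete (λ x → x * x ≤ a) (0# , 0∈) (_ , bounded)))
      where
      0∈ : 0# * 0# ≤ a
      0∈ = ≤-trans (≤-reflexive (zeroˡ 0#)) 0≤a
      bounded : UpperBound (λ x → x * x ≤ a) (a + 1#)
      bounded x xx≤a = x*x≤y*y⇒x≤y (+-nonneg 0≤a 0≤1) (≤-trans xx≤a
        (≤-from (+-nonneg (+-nonneg (0≤x*x a) 0≤a) 0≤1)
          (solve 1 (λ a → a :+ (a :* a :+ a :+ con (+ 1)) := (a :+ con (+ 1)) :* (a :+ con (+ 1))) refl a)))

-- Compactness of intervals, and the field ℂ with its squared modulus.

module ComplexNumbers (R : CompleteOrderedField) where

  open OrderedField R

  open PsdStability R
  open CompleteOrderedField R renaming (Carrier to ℝ)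
  open IntegerSolver commutativeRing

  -- The supremum of the points reachable from c lies inside the interval that
  -- `local` provides around it, so nothing short of d can be that supremum.

  abstract

    cousin : (Q : ℝ → ℝ → Set) → (∀ {u v w} → Q u v → Q v w → Q u w) →
      (∀ t → ¬ ¬ ∃ λ δ → 0# < δ × (∀ {u v} → t - δ ≤ u → u ≤ v → v ≤ t + δ → Q u v)) →
      ∀ {c d} → c ≤ d → ¬ ¬ Q c d
    cousin Q join local {c} {d} c≤d ¬Qcd = local c λ (δ , 0<δ , near) →
      creep (complete S (c , c≤d , contradiction (near (c-δ≤c 0<δ) ≤-refl (c≤c+δ 0<δ))) (d , λ _ → proj₁))
      where
      S : Pred ℝ 0ℓ
      S x = x ≤ d × ¬ ¬ Q c x
      c≤c+δ : ∀ {c δ} → 0# < δ → c ≤ c + δ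
      c≤c+δ 0<δ = ≤-from (<⇒≤ 0<δ) refl
      c-δ≤c : ∀ {c δ} → 0# < δ → c - δ ≤ c
      c-δ≤c {c} {δ} 0<δ = ≤-from (<⇒≤ 0<δ) (solve 2 (λ c δ → c :- δ :+ δ := c) refl c δ)
      creep : ¬ ∃ (LeastUpperBound S)
      creep (s , isLub) = local s λ (δ , 0<δ , near) → sup-approx isLub 0<δ λ x (x≤d , ¬¬Qcx) →
        ≮⇒≥ λ s-δ<x →
          let x≤s = proj₁ isLub x (x≤d , ¬¬Qcx)
              extend : ∀ {y} → x ≤ y → y ≤ s + δ → y ≤ d → S y
              extend x≤y y≤s+δ y≤d =
                y≤d , ¬¬-map (λ Qcx → join Qcx (near (<⇒≤ s-δ<x) x≤y y≤s+δ)) ¬¬Qcx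
          in stuck 0<δ x≤d x≤s extend (≤-<-connex d (s + δ))
        where
        stuck : ∀ {δ x} → 0# < δ → x ≤ d → x ≤ s → (∀ {y} → x ≤ y → y ≤ s + δ → y ≤ d → S y) →
          ¬ (d ≤ s + δ ⊎ s + δ < d)
        stuck 0<δ x≤d x≤s extend (inj₁ d≤s+δ) = proj₂ (extend x≤d d≤s+δ ≤-refl) ¬Qcd
        stuck 0<δ x≤d x≤s extend (inj₂ s+δ<d) =
          ≤⇒≯ (proj₁ isLub _ (extend (≤-trans x≤s (c≤c+δ 0<δ)) ≤-refl (<⇒≤ s+δ<d))) (<-from 0<δ refl)

  ℂ-commutativeRing : CommutativeRing 0ℓ 0ℓ
  ℂ-commutativeRing = record
    { Carrier = ℂ ; _≈_ = ℂ-ring._≈_ ; _+_ = ℂ-ring._+_ ; _*_ = ℂ-ring._*_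
    ; -_ = ℂ-ring.-_ ; 0# = ℂ-ring.0# ; 1# = ℂ-ring.1#
    ; isCommutativeRing = record
      { isRing = record
        { +-isAbelianGroup = record
          { isGroup = record
            { isMonoid = record
              { isSemigroup = record
                { isMagma = record
                  { isEquivalence = record
                    { refl  = refl , refl
                    ; sym   = λ (p , q) → sym p , sym q
                    ; trans = λ (p , q) (p′ , q′) → trans p p′ , trans q q′
                    }
                  ; ∙-cong = λ (p , q) (p′ , q′) → +-cong p p′ , +-cong q q′
                  }
                ; assoc = λ w u v → +-assoc _ _ _ , +-assoc _ _ _
                }
              ; identity = (λ w → +-identityˡ _ , +-identityˡ _) , λ w → +-identityʳ _ , +-identityʳ _
              }
            ; inverse = (λ w → -‿inverseˡ _ , -‿inverseˡ _) , λ w → -‿inverseʳ _ , -‿inverseʳ _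
            ; ⁻¹-cong = λ (p , q) → -‿cong p , -‿cong q
            }
          ; comm = λ w u → +-comm _ _ , +-comm _ _
          }
        ; *-cong = λ (p , q) (p′ , q′) →
            +-cong (*-cong p p′) (-‿cong (*-cong q q′)) , +-cong (*-cong p q′) (*-cong q p′)
        ; *-assoc = λ w u v →
            solve 6 (λ a b c d e f → (a :* c :- b :* d) :* e :- (a :* d :+ b :* c) :* f :=
                                     a :* (c :* e :- d :* f) :- b :* (c :* f :+ d :* e))
                    refl (re w) (im w) (re u) (im u) (re v) (im v)
          , solve 6 (λ a b c d e f → (a :* c :- b :* d) :* f :+ (a :* d :+ b :* c) :* e :=
                                     a :* (c :* f :+ d :* e) :+ b :* (c :* e :- d :* f))
                    refl (re w) (im w) (re u) (im u) (re v) (im v)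
        ; *-identity =
            (λ w → solve 2 (λ a b → con (+ 1) :* a :- con (+ 0) :* b := a) refl (re w) (im w)
                 , solve 2 (λ a b → con (+ 1) :* b :+ con (+ 0) :* a := b) refl (re w) (im w))
          , (λ w → solve 2 (λ a b → a :* con (+ 1) :- b :* con (+ 0) := a) refl (re w) (im w)
                 , solve 2 (λ a b → a :* con (+ 0) :+ b :* con (+ 1) := b) refl (re w) (im w))
        ; distrib =
            (λ w u v → solve 6 (λ a b c d e f → a :* (c :+ e) :- b :* (d :+ f) :=
                                                a :* c :- b :* d :+ (a :* e :- b :* f))
                               refl (re w) (im w) (re u) (im u) (re v) (im v)
                     , solve 6 (λ a b c d e f → a :* (d :+ f) :+ b :* (c :+ e) :=
                                                a :* d :+ b :* c :+ (a :* f :+ b :* e))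
                               refl (re w) (im w) (re u) (im u) (re v) (im v))
          , (λ w u v → solve 6 (λ a b c d e f → (c :+ e) :* a :- (d :+ f) :* b :=
                                                c :* a :- d :* b :+ (e :* a :- f :* b))
                               refl (re w) (im w) (re u) (im u) (re v) (im v)
                     , solve 6 (λ a b c d e f → (c :+ e) :* b :+ (d :+ f) :* a :=
                                                c :* b :+ d :* a :+ (e :* b :+ f :* a))
                               refl (re w) (im w) (re u) (im u) (re v) (im v))
        }
      ; *-comm = λ w u →
          solve 4 (λ a b c d → a :* c :- b :* d := c :* a :- d :* b) refl (re w) (im w) (re u) (im u)
        , solve 4 (λ a b c d → a :* d :+ b :* c := c :* b :+ d :* a) refl (re w) (im w) (re u) (im u)
      }
    }

  module 𝐂 where
    open CommutativeRing ℂ-commutativeRing public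
    open import Algebra.Properties.CommutativeSemiring.Exp (CommutativeRing.commutativeSemiring ℂ-commutativeRing) public
    open IntegerSolver ℂ-commutativeRing public

  open 𝐂 using () renaming (_≈_ to _≈ᶜ_; _+_ to _+ᶜ_; _*_ to _*ᶜ_; -_ to -ᶜ_; _^_ to _^ᶜ_; 0# to 0ᶜ; 1# to 1ᶜ) public

  infix 4 _≟ᶜ_
  _≟ᶜ_ : ∀ w u → Dec (w ≈ᶜ u)
  w ≟ᶜ u = (re w ≟ re u) ×-dec (im w ≟ im u)

  ι : ℝ → ℂ
  ι x = x +i 0#

  𝕚 : ℂ
  𝕚 = 0# +i 1#

  conj : ℂ → ℂ
  conj w = re w +i - im w

  dot : ℂ → ℂ → ℝ
  dot w u = re w * re u + im w * im u

  -- The squared modulus replaces the modulus in all estimates, which thereby become polynomial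
  -- identities with nonnegative remainders.
  N : ℂ → ℝ
  N w = dot w w

  N-cong : ∀ {w u} → w ≈ᶜ u → N w ≈ N u
  N-cong (p , q) = +-cong (*-cong p p) (*-cong q q)

  abstract

    N-* : ∀ w u → N (w *ᶜ u) ≈ N w * N u
    N-* w u = solve 4 (λ a b c d →
      (a :* c :- b :* d) :* (a :* c :- b :* d) :+ (a :* d :+ b :* c) :* (a :* d :+ b :* c) :=
      (a :* a :+ b :* b) :* (c :* c :+ d :* d)) refl (re w) (im w) (re u) (im u)

    0≤N : ∀ w → 0# ≤ N w
    0≤N w = +-nonneg (0≤x*x (re w)) (0≤x*x (im w))

    ≉0⇒0<N : ∀ {w} → ¬ (w ≈ᶜ 0ᶜ) → 0# < N w
    ≉0⇒0<N {w} w≉0 with re w ≟ 0#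
    ... | no  a≉0 = pos+nonneg (≉0⇒0<x*x a≉0) (0≤x*x (im w))
    ... | yes a≈0 = nonneg+pos (0≤x*x (re w)) (≉0⇒0<x*x λ b≈0 → w≉0 (a≈0 , b≈0))

    N0≈0 : ∀ {w} → w ≈ᶜ 0ᶜ → N w ≈ 0#
    N0≈0 (p , q) = trans (N-cong (p , q)) (solve 0 (con (+ 0) :* con (+ 0) :+ con (+ 0) :* con (+ 0) := con (+ 0)) refl)

    0<N⇒≉0 : ∀ {w} → 0# < N w → ¬ (w ≈ᶜ 0ᶜ)
    0<N⇒≉0 0<N w≈0 = 0<⇒≉0 0<N (N0≈0 w≈0)

    *-≉0 : ∀ {w u} → ¬ (w ≈ᶜ 0ᶜ) → ¬ (u ≈ᶜ 0ᶜ) → ¬ (w *ᶜ u ≈ᶜ 0ᶜ)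
    *-≉0 {w} {u} w≉0 u≉0 = 0<N⇒≉0 (<-respʳ (sym (N-* w u)) (*-pos (≉0⇒0<N w≉0) (≉0⇒0<N u≉0)))

    -- The parallelogram law with |w - u|² dropped; it plays the part of the triangle inequality.
    N-+ : ∀ w u → N (w +ᶜ u) ≤ 2# * (N w + N u)
    N-+ w u = ≤-from (+-nonneg (0≤x*x (re w - re u)) (0≤x*x (im w - im u)))
      (solve 4 (λ a b c d →
        (a :+ c) :* (a :+ c) :+ (b :+ d) :* (b :+ d) :+ ((a :- c) :* (a :- c) :+ (b :- d) :* (b :- d)) :=
        con (+ 2) :* (a :* a :+ b :* b :+ (c :* c :+ d :* d))) refl (re w) (im w) (re u) (im u))

    -- The parallelogram law for w + u and w, whose difference is u; the square of their sum is
    -- dropped.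
    N-+-lower : ∀ w u → N u ≤ 2# * (N (w +ᶜ u) + N w)
    N-+-lower w u = ≤-from (+-nonneg (0≤x*x (re w + re w + re u)) (0≤x*x (im w + im w + im u)))
      (solve 4 (λ a b c d →
        c :* c :+ d :* d :+ ((a :+ a :+ c) :* (a :+ a :+ c) :+ (b :+ b :+ d) :* (b :+ b :+ d)) :=
        con (+ 2) :* ((a :+ c) :* (a :+ c) :+ (b :+ d) :* (b :+ d) :+ (a :* a :+ b :* b)))
        refl (re w) (im w) (re u) (im u))

    -- The dropped square is the one in Lagrange's identity. Passing through s avoids taking the
    -- square root of `N w * N u`.
    cauchy-schwarz : ∀ w u {s} → 0# ≤ s → N w * N u ≤ s * s → dot w u ≤ s
    cauchy-schwarz w u 0≤s NN≤ss = x*x≤y*y⇒x≤y 0≤s (≤-trans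
      (≤-from (0≤x*x (re w * im u - im w * re u))
        (solve 4 (λ a b c d →
          (a :* c :+ b :* d) :* (a :* c :+ b :* d) :+ (a :* d :- b :* c) :* (a :* d :- b :* c) :=
          (a :* a :+ b :* b) :* (c :* c :+ d :* d)) refl (re w) (im w) (re u) (im u)))
      NN≤ss)

-- Directions u in which w u^k has negative real part.

module Directions (R : CompleteOrderedField) where

  open OrderedField R
  open ComplexNumbers R

  open +-*-Solver using () renaming (solve to ℕ-solve; con to ℕ-con; _:+_ to _:+ℕ_; _:*_ to _:*ℕ_; _:=_ to _:=ℕ_)

  open PsdStability R
  open CompleteOrderedField R renaming (Carrier to ℝ)
  open IntegerSolver commutativeRing

  parity : ∀ k → ∃ λ j → k ≡ j ℕ.+ j ⊎ k ≡ suc (j ℕ.+ j)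
  parity zero = 0 , inj₁ ≡.refl
  parity (suc k) with parity k
  ... | j , inj₁ ≡.refl = j , inj₂ ≡.refl
  ... | j , inj₂ ≡.refl = suc j , inj₁ (≡.sym (≡.cong suc (ℕ.+-suc j j)))

  1^n≈1 : ∀ n → 1ᶜ ^ᶜ n ≈ᶜ 1ᶜ
  1^n≈1 zero    = 𝐂.refl
  1^n≈1 (suc n) = 𝐂.trans (𝐂.*-identityˡ _) (1^n≈1 n)

  abstract

    ι-* : ∀ x y → ι x *ᶜ ι y ≈ᶜ ι (x * y)
    ι-* x y = solve 2 (λ x y → x :* y :- con (+ 0) :* con (+ 0) := x :* y) refl x y
            , solve 2 (λ x y → x :* con (+ 0) :+ con (+ 0) :* y := con (+ 0)) refl x y

    re-ι* : ∀ x w → re (ι x *ᶜ w) ≈ x * re w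
    re-ι* x w = solve 3 (λ x a b → x :* a :- con (+ 0) :* b := x :* a) refl x (re w) (im w)

    N-ι : ∀ x → N (ι x) ≈ x * x
    N-ι x = solve 1 (λ x → x :* x :+ con (+ 0) :* con (+ 0) := x :* x) refl x

    ι-^ : ∀ {t} n → 0# < t → ∃ λ τ → 0# < τ × ι t ^ᶜ n ≈ᶜ ι τ × (t ≤ 1# → τ ≤ 1#)
    ι-^     zero    0<t = 1# , 0<1 , 𝐂.refl , λ _ → ≤-refl
    ι-^ {t} (suc n) 0<t =
      let τ , 0<τ , eq , bound = ι-^ n 0<t
      in t * τ , *-pos 0<t 0<τ , 𝐂.trans (𝐂.*-congˡ eq) (ι-* t τ) , λ t≤1 →
        ≤-trans (≤-from (*-nonneg (<⇒≤ 0<t) (≤-diff (bound t≤1)))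
          (solve 2 (λ t τ → t :* τ :+ t :* (con (+ 1) :- τ) := t) refl t τ)) t≤1

    ι-^-suc : ∀ {t} n → 0# < t → t ≤ 1# → ∃ λ τ → 0# < τ × τ ≤ t × ι t ^ᶜ suc n ≈ᶜ ι τ
    ι-^-suc {t} n 0<t t≤1 =
      let τ , 0<τ , eq , bound = ι-^ n 0<t
      in t * τ , *-pos 0<t 0<τ
        , ≤-from (*-nonneg (<⇒≤ 0<t) (≤-diff (bound t≤1)))
            (solve 2 (λ t τ → t :* τ :+ t :* (con (+ 1) :- τ) := t) refl t τ)
        , 𝐂.trans (𝐂.*-congˡ eq) (ι-* t τ)

  -- Every u is, up to a positive factor, the square of u + |u|, unless u ≤ 0.

  abstract

    square-direction : ∀ u → ∃ λ v → ∃ λ c → 0# < c × v *ᶜ v ≈ᶜ ι c *ᶜ u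
    square-direction u with im u ≟ 0# | ≤-<-connex 0# (re u) | re u ≟ 0#
    ... | yes b≈0 | _ | yes a≈0 = 0ᶜ , 1# , 0<1
        , 𝐂.trans (𝐂.zeroˡ 0ᶜ) (𝐂.sym (𝐂.trans (𝐂.*-congˡ (a≈0 , b≈0)) (𝐂.zeroʳ (ι 1#))))
    ... | yes b≈0 | inj₁ (inj₁ 0<a) | no _ = u , re u , 0<a , 𝐂.*-congʳ (refl , b≈0)
    ... | yes b≈0 | inj₁ (inj₂ 0≈a) | no a≉0 = ⊥-elim (a≉0 (sym 0≈a))
    ... | yes b≈0 | inj₂ a<0 | no _ = 𝕚 *ᶜ u , - re u , neg⇒pos a<0
        , 𝐂.trans (solve 2 (λ a b → (con (+ 0) :* a :- con (+ 1) :* b) :* (con (+ 0) :* a :- con (+ 1) :* b) :-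
                                    (con (+ 0) :* b :+ con (+ 1) :* a) :* (con (+ 0) :* b :+ con (+ 1) :* a) :=
                                    (:- a) :* a :- (:- b) :* b) refl (re u) (im u)
                  , solve 2 (λ a b → (con (+ 0) :* a :- con (+ 1) :* b) :* (con (+ 0) :* b :+ con (+ 1) :* a) :+
                                     (con (+ 0) :* b :+ con (+ 1) :* a) :* (con (+ 0) :* a :- con (+ 1) :* b) :=
                                    (:- a) :* b :+ (:- b) :* a) refl (re u) (im u))
            (𝐂.*-congʳ {u} (refl , trans (-‿cong b≈0) (solve 0 (:- con (+ 0) := con (+ 0)) refl)))
    ... | no b≉0 | _ | _ =
      -- Since r² is u times its conjugate, (u + r)² = 2(r + re u) u; a nonzero imaginary part makes
      -- r exceed |re u|.
      let r , 0≤r , rr≈N = sqrt (0≤N u)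
          0<r+a = pos r 0≤r rr≈N b≉0
      in u +ᶜ ι r , (r + re u) + (r + re u) , pos+nonneg 0<r+a (<⇒≤ 0<r+a) , eq r rr≈N
      where
      pos : ∀ r → 0# ≤ r → r * r ≈ N u → ¬ (im u ≈ 0#) → 0# < r + re u
      pos r 0≤r rr≈N b≉0 with ≤-<-connex (r + re u) 0#
      ... | inj₂ 0<r+a = 0<r+a
      ... | inj₁ r+a≤0 = ⊥-elim (≤⇒≯
        (x≤y⇒x*x≤y*y 0≤r (≤-from (≤-diff r+a≤0) (solve 2 (λ r a → r :+ (con (+ 0) :- (r :+ a)) := :- a) refl r (re u))))
        (<-respʳ (sym rr≈N) (<-from (≉0⇒0<x*x b≉0)
          (solve 2 (λ a b → (:- a) :* (:- a) :+ b :* b := a :* a :+ b :* b) refl (re u) (im u)))))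
      eq : ∀ r → r * r ≈ N u →
        (u +ᶜ ι r) *ᶜ (u +ᶜ ι r) ≈ᶜ ι ((r + re u) + (r + re u)) *ᶜ u
      eq r rr≈N =
          trans (solve 3 (λ a b r → (a :+ r) :* (a :+ r) :- (b :+ con (+ 0)) :* (b :+ con (+ 0)) :=
                                    r :* r :+ (a :* a :- b :* b :+ (r :+ r) :* a)) refl (re u) (im u) r)
            (trans (+-congʳ rr≈N)
              (solve 3 (λ a b r → (a :* a :+ b :* b) :+ (a :* a :- b :* b :+ (r :+ r) :* a) :=
                                  (r :+ a :+ (r :+ a)) :* a :- con (+ 0) :* b) refl (re u) (im u) r))
        , solve 3 (λ a b r → (a :+ r) :* (b :+ con (+ 0)) :+ (b :+ con (+ 0)) :* (a :+ r) :=
                             (r :+ a :+ (r :+ a)) :* b :+ con (+ 0) :* a) refl (re u) (im u) r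

    ²≈-1⇒⁴≈1 : ∀ {y} → y *ᶜ y ≈ᶜ -ᶜ 1ᶜ → y ^ᶜ 4 ≈ᶜ 1ᶜ
    ²≈-1⇒⁴≈1 {y} y²≈-1 = 𝐂.trans
      (𝐂.solve 1 (λ y → y 𝐂.:^ 4 𝐂.:= (y 𝐂.:* y) 𝐂.:* (y 𝐂.:* y)) 𝐂.refl y)
      (𝐂.trans (𝐂.*-cong y²≈-1 y²≈-1)
        (𝐂.solve 0 ((𝐂.:- 𝐂.con (+ 1)) 𝐂.:* (𝐂.:- 𝐂.con (+ 1)) 𝐂.:= 𝐂.con (+ 1)) 𝐂.refl))

    𝕚²≈-1 : 𝕚 *ᶜ 𝕚 ≈ᶜ -ᶜ 1ᶜ
    𝕚²≈-1 = solve 0 (con (+ 0) :* con (+ 0) :- con (+ 1) :* con (+ 1) := :- con (+ 1)) refl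
          , solve 0 (con (+ 0) :* con (+ 1) :+ con (+ 1) :* con (+ 0) := :- con (+ 0)) refl

    -- Some quarter turn of a nonzero w, by 1, -1, `𝕚` or `-ᶜ 𝕚`, lies in the open left half plane.
    fourth-root-direction : ∀ {w} → ¬ (w ≈ᶜ 0ᶜ) → ∃ λ y → y ^ᶜ 4 ≈ᶜ 1ᶜ × re (w *ᶜ y) < 0#
    fourth-root-direction {w} w≉0 with re w ≟ 0# | im w ≟ 0# | ≤-<-connex 0# (re w) | ≤-<-connex 0# (im w)
    ... | yes a≈0 | yes b≈0 | _ | _ = ⊥-elim (w≉0 (a≈0 , b≈0))
    ... | no a≉0 | _ | inj₁ (inj₂ 0≈a) | _ = ⊥-elim (a≉0 (sym 0≈a))
    ... | _ | no b≉0 | _ | inj₁ (inj₂ 0≈b) = ⊥-elim (b≉0 (sym 0≈b))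
    ... | no _ | _ | inj₂ a<0 | _ = 1ᶜ , 1^n≈1 4
        , <-respˡ (solve 2 (λ a b → a := a :* con (+ 1) :- b :* con (+ 0)) refl (re w) (im w)) a<0
    ... | no _ | _ | inj₁ (inj₁ 0<a) | _ = -ᶜ 1ᶜ
        , 𝐂.solve 0 ((𝐂.:- 𝐂.con (+ 1)) 𝐂.:^ 4 𝐂.:= 𝐂.con (+ 1)) 𝐂.refl
        , <-from 0<a (solve 2 (λ a b → a :* (:- con (+ 1)) :- b :* (:- con (+ 0)) :+ a := con (+ 0)) refl (re w) (im w))
    ... | yes _ | no _ | _ | inj₁ (inj₁ 0<b) = 𝕚 , ²≈-1⇒⁴≈1 𝕚²≈-1
        , <-from 0<b (solve 2 (λ a b → a :* con (+ 0) :- b :* con (+ 1) :+ b := con (+ 0)) refl (re w) (im w))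
    ... | yes _ | no _ | _ | inj₂ b<0 = -ᶜ 𝕚
        , ²≈-1⇒⁴≈1 (𝐂.trans (𝐂.solve 1 (λ y → (𝐂.:- y) 𝐂.:* (𝐂.:- y) 𝐂.:= y 𝐂.:* y) 𝐂.refl 𝕚) 𝕚²≈-1)
        , <-respˡ (solve 2 (λ a b → b := a :* (:- con (+ 0)) :- b :* (:- con (+ 1))) refl (re w) (im w)) b<0

    -- Strong induction avoids k-th roots. For k = 2j, a square root, up to a positive factor, of a
    -- direction for j works. For odd k, a fourth root of unity y is itself a k-th power, namely of
    -- y^k, because k² leaves remainder 1 modulo 4.
    direction : ∀ k → 0 ℕ.< k → ∀ {w} → ¬ (w ≈ᶜ 0ᶜ) → ∃ λ u → re (w *ᶜ u ^ᶜ k) < 0#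
    direction = <-rec (λ k → 0 ℕ.< k → ∀ {w} → ¬ (w ≈ᶜ 0ᶜ) → ∃ λ u → re (w *ᶜ u ^ᶜ k) < 0#)
      λ k rec 0<k → step k (parity k) rec 0<k
      where
      step : ∀ k → (∃ λ j → k ≡ j ℕ.+ j ⊎ k ≡ suc (j ℕ.+ j)) →
        (∀ {j} → j ℕ.< k → 0 ℕ.< j → ∀ {w} → ¬ (w ≈ᶜ 0ᶜ) → ∃ λ u → re (w *ᶜ u ^ᶜ j) < 0#) →
        0 ℕ.< k → ∀ {w} → ¬ (w ≈ᶜ 0ᶜ) → ∃ λ u → re (w *ᶜ u ^ᶜ k) < 0#
      step _ (zero  , inj₁ ≡.refl) _ ()
      step _ (suc j , inj₁ ≡.refl) rec _ {w} w≉0 =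
        let u , neg          = rec {suc j} (ℕ.m<m+n (suc j) ℕ.z<s) ℕ.z<s w≉0
            v , c , 0<c , eq = square-direction u
            c′ , 0<c′ , eq′ , _ = ι-^ (suc j) 0<c
            open SetoidReasoning 𝐂.setoid
            v^k = begin
              w *ᶜ v ^ᶜ (suc j ℕ.+ suc j)               ≈⟨ 𝐂.*-congˡ (𝐂.^-homo-* v (suc j) (suc j)) ⟩
              w *ᶜ (v ^ᶜ suc j *ᶜ v ^ᶜ suc j)           ≈⟨ 𝐂.*-congˡ (𝐂.^-distrib-* v v (suc j)) ⟨
              w *ᶜ (v *ᶜ v) ^ᶜ suc j                    ≈⟨ 𝐂.*-congˡ (𝐂.^-congˡ (suc j) eq) ⟩
              w *ᶜ (ι c *ᶜ u) ^ᶜ suc j                  ≈⟨ 𝐂.*-congˡ (𝐂.^-distrib-* (ι c) u (suc j)) ⟩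
              w *ᶜ (ι c ^ᶜ suc j *ᶜ u ^ᶜ suc j)         ≈⟨ 𝐂.*-congˡ (𝐂.*-congʳ eq′) ⟩
              w *ᶜ (ι c′ *ᶜ u ^ᶜ suc j)                 ≈⟨ 𝐂.solve 3 (λ w c u →
                                                             w 𝐂.:* (c 𝐂.:* u) 𝐂.:= c 𝐂.:* (w 𝐂.:* u))
                                                             𝐂.refl w (ι c′) (u ^ᶜ suc j) ⟩
              ι c′ *ᶜ (w *ᶜ u ^ᶜ suc j)                 ∎
        in v , <-respˡ (sym (trans (proj₁ v^k) (re-ι* c′ _)))
          (<-from (*-pos 0<c′ (neg⇒pos neg)) (solve 2 (λ c x → c :* x :+ c :* (:- x) := con (+ 0)) refl c′ _))
      step _ (j , inj₂ ≡.refl) rec _ {w} w≉0 =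
        let y , y⁴≈1 , neg = fourth-root-direction w≉0
            k = suc (j ℕ.+ j)
            -- (2j + 1)² = 1 + 4e, so y^(k²) = y (y⁴)^e = y.
            e = j ℕ.* j ℕ.+ j
            open SetoidReasoning 𝐂.setoid
            [y^k]^k = begin
              (y ^ᶜ k) ^ᶜ k           ≈⟨ 𝐂.^-assocʳ y k k ⟩
              y ^ᶜ (k ℕ.* k)          ≡⟨ ≡.cong (y ^ᶜ_) (ℕ-solve 1 (λ j →
                                           (ℕ-con 1 :+ℕ (j :+ℕ j)) :*ℕ (ℕ-con 1 :+ℕ (j :+ℕ j)) :=ℕ
                                           ℕ-con 1 :+ℕ ℕ-con 4 :*ℕ (j :*ℕ j :+ℕ j)) ≡.refl j) ⟩
              y *ᶜ y ^ᶜ (4 ℕ.* e)     ≈⟨ 𝐂.*-congˡ (𝐂.^-assocʳ y 4 e) ⟨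
              y *ᶜ (y ^ᶜ 4) ^ᶜ e      ≈⟨ 𝐂.*-congˡ (𝐂.^-congˡ e y⁴≈1) ⟩
              y *ᶜ 1ᶜ ^ᶜ e            ≈⟨ 𝐂.*-congˡ (1^n≈1 e) ⟩
              y *ᶜ 1ᶜ                 ≈⟨ 𝐂.*-identityʳ y ⟩
              y                       ∎
        in y ^ᶜ k , <-respˡ (proj₁ (𝐂.*-congˡ {w} (𝐂.sym [y^k]^k))) neg

-- Growth, expansion about a point and semicontinuity of complex polynomials.

module ComplexPolynomials (R : CompleteOrderedField) where

  open OrderedField R
  open ComplexNumbers R
  open Directions R

  open PsdStability R
  open CompleteOrderedField R renaming (Carrier to ℝ)
  open IntegerSolver commutativeRing

  open Univariate ℂ-commutativeRing public

  nonzero? : ∀ a D → Nonzero a D ⊎ AllZero a D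
  nonzero? a zero = inj₂ λ ()
  nonzero? a (suc D) with a 0 ≟ᶜ 0ᶜ | nonzero? (a ∘ suc) D
  ... | no a≉0  | _          = inj₁ (0 , ℕ.z<s , a≉0)
  ... | yes _   | inj₁ nz    = inj₁ (nonzero-suc nz)
  ... | yes a≈0 | inj₂ zeros = inj₂ λ { {zero} _ → a≈0 ; {suc d} (ℕ.s<s d<D) → zeros d<D }

  abstract

    bounded : ∀ a D {ρ} → 0# ≤ ρ → ∃ λ C → 0# ≤ C × (∀ h → N h ≤ ρ → N (poly a D h) ≤ C)
    bounded a zero        0≤ρ = 0# , ≤-refl , λ h _ → ≤-reflexive (N0≈0 𝐂.refl)
    bounded a (suc D) {ρ} 0≤ρ =
      let C , 0≤C , bound = bounded (a ∘ suc) D 0≤ρ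
      in 2# * (N (a 0) + ρ * C)
       , *-nonneg (<⇒≤ 0<2) (+-nonneg (0≤N (a 0)) (*-nonneg 0≤ρ 0≤C))
       , λ h Nh≤ρ → let q = poly (a ∘ suc) D h in ≤-trans (N-+ (a 0) (h *ᶜ q))
           (≤-from (*-nonneg (<⇒≤ 0<2) (+-nonneg (*-nonneg (≤-diff Nh≤ρ) 0≤C) (*-nonneg (0≤N h) (≤-diff (bound h Nh≤ρ)))))
             (trans (+-congʳ (*-congˡ (+-congˡ (N-* h q))))
               (solve 5 (λ n h q ρ C → con (+ 2) :* (n :+ h :* q) :+
                                       con (+ 2) :* ((ρ :- h) :* C :+ h :* (C :- q)) :=
                                       con (+ 2) :* (n :+ ρ :* C)) refl (N (a 0)) (N h) (N q) ρ C)))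

    grows : ∀ c (q : ℂ → ℂ) {ε ρ} → 0# < ε → (∀ z → ρ ≤ N z → ε ≤ N (q z)) →
      ∀ K → ∃ λ ρ′ → ∀ z → ρ′ ≤ N z → K ≤ N (c +ᶜ z *ᶜ q z)
    grows c q {ε} {ρ} 0<ε bound K =
      let e , 0<e , εe≈1 = inverse-pos 0<ε
          -- From N z ≥ 2(K + N c)/ε and N (q z) ≥ ε follows N (z q z) ≥ 2(K + N c), and `N-+-lower`
          -- then absorbs the constant c.
          ρ′ , ρ≤ρ′ , B≤ρ′ = upper ρ (2# * (K + N c) * e)
      in ρ′ , λ z ρ′≤Nz → *-pos-cancelˡ-≤ 0<2
          (≤-trans
            (≤-from (+-nonneg (+-nonneg
                (*-nonneg (<⇒≤ 0<ε) (≤-diff (≤-trans B≤ρ′ ρ′≤Nz)))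
                (*-nonneg (0≤N z) (≤-diff (bound z (≤-trans ρ≤ρ′ ρ′≤Nz)))))
                (≤-diff (≤-trans (≤-reflexive (sym (N-* z (q z)))) (N-+-lower c (z *ᶜ q z)))))
              (trans
                (solve 7 (λ K n e ε z q p →
                  con (+ 2) :* K :+ (ε :* (z :- con (+ 2) :* (K :+ n) :* e) :+ z :* (q :- ε) :+
                                     (con (+ 2) :* (p :+ n) :- z :* q)) :=
                  con (+ 2) :* p :+ con (+ 2) :* (K :+ n) :* (con (+ 1) :- ε :* e))
                  refl K (N c) e ε (N z) (N (q z)) (N (c +ᶜ z *ᶜ q z)))
                (+-congˡ (*-congˡ (+-congˡ (-‿cong εe≈1))))))
            (≤-reflexive (solve 2 (λ p x → con (+ 2) :* p :+ x :* (con (+ 1) :- con (+ 1)) := con (+ 2) :* p) refl _ _)))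

    -- Mutual induction along Horner's form with `nonconstant⇒grows`: if the tail has a nonzero
    -- coefficient the polynomial grows, otherwise it equals its nonzero constant term.
    nonzero⇒away : ∀ a D → Nonzero a D → ∃ λ ε → ∃ λ ρ → 0# < ε × (∀ z → ρ ≤ N z → ε ≤ N (poly a D z))
    nonconstant⇒grows : ∀ a D → Nonzero (a ∘ suc) D →
      ∀ K → ∃ λ ρ → ∀ z → ρ ≤ N z → K ≤ N (poly a (suc D) z)
    nonconstant⇒grows a D nz =
      let ε , ρ , 0<ε , bound = nonzero⇒away (a ∘ suc) D nz in grows (a 0) (poly (a ∘ suc) D) 0<ε bound
    nonzero⇒away a zero (_ , () , _)
    nonzero⇒away a (suc D) (d , d<D , ad≉0) with nonzero? (a ∘ suc) D
    ... | inj₁ nz    = let ρ , bound = nonconstant⇒grows a D nz 1# in 1# , ρ , 0<1 , bound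
    ... | inj₂ zeros = N (a 0) , 0# , ≉0⇒0<N (a0≉0 d d<D ad≉0) , λ z _ →
        ≤-reflexive (sym (N-cong (poly-constant a D z zeros)))
      where
      a0≉0 : ∀ d → d ℕ.< suc D → ¬ (a d ≈ᶜ 0ᶜ) → ¬ (a 0 ≈ᶜ 0ᶜ)
      a0≉0 zero    _           ad≉0 = ad≉0
      a0≉0 (suc d) (ℕ.s<s d<D) ad≉0 = ⊥-elim (ad≉0 (zeros d<D))

    times-linear : ∀ b D z₀ → ∃ λ c → ∀ h → poly c (suc D) h ≈ᶜ (z₀ +ᶜ h) *ᶜ poly b D h
    times-linear b zero z₀ = (λ _ → 0ᶜ) , λ h → 𝐂.solve 2 (λ z h →
      𝐂.con (+ 0) 𝐂.:+ h 𝐂.:* 𝐂.con (+ 0) 𝐂.:= (z 𝐂.:+ h) 𝐂.:* 𝐂.con (+ 0)) 𝐂.refl z₀ h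
    times-linear b (suc D) z₀ =
      let c , eq = times-linear (b ∘ suc) D z₀
      in (λ { zero → z₀ *ᶜ b 0 ; (suc zero) → b 0 +ᶜ c 0 ; (suc (suc d)) → c (suc d) })
       , λ h → 𝐂.trans
          (𝐂.solve 5 (λ z h b c q → z 𝐂.:* b 𝐂.:+ h 𝐂.:* (b 𝐂.:+ c 𝐂.:+ h 𝐂.:* q) 𝐂.:=
                                    z 𝐂.:* b 𝐂.:+ h 𝐂.:* b 𝐂.:+ h 𝐂.:* (c 𝐂.:+ h 𝐂.:* q))
            𝐂.refl z₀ h (b 0) (c 0) (poly (c ∘ suc) D h))
          (𝐂.trans (𝐂.+-congˡ (𝐂.*-congˡ (eq h)))
            (𝐂.solve 4 (λ z h b q → z 𝐂.:* b 𝐂.:+ h 𝐂.:* b 𝐂.:+ h 𝐂.:* ((z 𝐂.:+ h) 𝐂.:* q) 𝐂.:=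
                                    (z 𝐂.:+ h) 𝐂.:* (b 𝐂.:+ h 𝐂.:* q))
              𝐂.refl z₀ h (b 0) (poly (b ∘ suc) D h)))

    -- Horner's scheme: the tail is expanded by induction and `times-linear` multiplies the result
    -- by z₀ + h. The length stays D.
    taylor : ∀ a D z₀ → ∃ λ b → ∀ h → poly a D (z₀ +ᶜ h) ≈ᶜ poly b D h
    taylor a zero    z₀ = a , λ h → 𝐂.refl
    taylor a (suc D) z₀ =
      let b , eq  = taylor (a ∘ suc) D z₀
          c , eq′ = times-linear b D z₀
      in (λ { zero → a 0 +ᶜ c 0 ; (suc d) → c (suc d) })
       , λ h → 𝐂.trans (𝐂.+-congˡ (𝐂.trans (𝐂.*-congˡ (eq h)) (𝐂.sym (eq′ h)))) (𝐂.sym (𝐂.+-assoc _ _ _))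

    -- Isolates the term that dominates near h = 0.
    lowest-term : ∀ a D → Nonzero a D →
      ∃ λ k → ∃ λ b → ∃ λ E → ¬ (b 0 ≈ᶜ 0ᶜ) × (∀ h → poly a D h ≈ᶜ h ^ᶜ k *ᶜ poly b (suc E) h)
    lowest-term a zero (_ , () , _)
    lowest-term a (suc D) (d , d<D , ad≉0) with a 0 ≟ᶜ 0ᶜ
    ... | no  a0≉0 = 0 , a , D , a0≉0 , λ h → 𝐂.sym (𝐂.*-identityˡ _)
    ... | yes a0≈0 =
      let k , b , E , b≉0 , eq = lowest-term (a ∘ suc) D (rest d d<D ad≉0)
      in suc k , b , E , b≉0 , λ h → 𝐂.trans (𝐂.+-cong a0≈0 (𝐂.*-congˡ (eq h)))
           (𝐂.solve 3 (λ h p q → 𝐂.con (+ 0) 𝐂.:+ h 𝐂.:* (p 𝐂.:* q) 𝐂.:= h 𝐂.:* p 𝐂.:* q)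
             𝐂.refl h (h ^ᶜ k) (poly b (suc E) h))
      where
      rest : ∀ d → d ℕ.< suc D → ¬ (a d ≈ᶜ 0ᶜ) → Nonzero (a ∘ suc) D
      rest zero    _           ad≉0 = ⊥-elim (ad≉0 a0≈0)
      rest (suc d) (ℕ.s<s d<D) ad≉0 = d , d<D , ad≉0

    -- Only this half of continuity is needed to keep |p|² away from its infimum locally.
    lower-semicontinuous : ∀ b D {m} → m < N (b 0) →
      ∃ λ ε → ∃ λ δ → 0# < ε × 0# < δ × (∀ h → N h ≤ δ → m + ε ≤ N (poly b (suc D) h))
    lower-semicontinuous b D {m} m<N =
      -- The gap N (b 0) - m equals 2g = 4s. In N (b 0 + e) the cross term costs at most 2s = g,
      -- which leaves m + g.
      let g , 0<g , g+g≈ = halve (<-diff m<N)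
          s , 0<s , s+s≈ = halve 0<g
          C , 0≤C , bound = bounded (b ∘ suc) D 0≤1
          δ , 0<δ , δ≤1 , small = *-small (*-nonneg (0≤N (b 0)) 0≤C) (*-pos 0<s 0<s)
      in g , δ , 0<g , 0<δ , λ h Nh≤δ →
        let q = poly (b ∘ suc) D h
            e = h *ᶜ q
            dot≤s = cauchy-schwarz (-ᶜ b 0) e (<⇒≤ 0<s) (≤-trans
              (≤-from (*-nonneg (0≤N (b 0)) (*-nonneg (0≤N h) (≤-diff (bound h (≤-trans Nh≤δ δ≤1)))))
                (trans (+-congʳ (*-cong
                    (solve 2 (λ a b → (:- a) :* (:- a) :+ (:- b) :* (:- b) := a :* a :+ b :* b) refl (re (b 0)) (im (b 0)))
                    (N-* h q)))
                  (solve 4 (λ n h q C → n :* (h :* q) :+ n :* (h :* (C :- q)) := n :* C :* h) refl (N (b 0)) (N h) (N q) C)))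
              (small Nh≤δ))
        in ≤-from (+-nonneg (*-nonneg (<⇒≤ 0<2) (≤-diff dot≤s)) (0≤N e))
             (trans
               (trans (+-congˡ (+-congʳ (trans
                   (solve 2 (λ s d → con (+ 2) :* (s :- d) := s :+ s :- con (+ 2) :* d) refl s _)
                   (+-congʳ s+s≈))))
                 (trans (solve 4 (λ m g d n → m :+ g :+ (g :- con (+ 2) :* d :+ n) := m :+ (g :+ g) :+ (n :- con (+ 2) :* d)) refl m g _ _)
                   (+-congʳ (+-congˡ g+g≈))))
               (solve 5 (λ m a b c d →
                 m :+ (a :* a :+ b :* b :- m) :+ (c :* c :+ d :* d :- con (+ 2) :* ((:- a) :* c :+ (:- b) :* d)) :=
                 (a :+ c) :* (a :+ c) :+ (b :+ d) :* (b :+ d)) refl m (re (b 0)) (im (b 0)) (re e) (im e)))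

-- D'Alembert's descent and the fundamental theorem of algebra.

module FundamentalTheorem (R : CompleteOrderedField) where

  open OrderedField R
  open ComplexNumbers R
  open Directions R
  open ComplexPolynomials R

  open PsdStability R
  open CompleteOrderedField R renaming (Carrier to ℝ)
  open IntegerSolver commutativeRing

  abstract

    -- The change of N is τ (2 dot b v + 2 dot b r + τ N (v + r)), at most τ (-4σ + 2σ + σ) = -τσ.
    descent-step : ∀ b v r {σ τ} → 0# < σ → 0# < τ → σ + σ ≈ - dot b v → dot b r ≤ σ →
      τ * N (v +ᶜ r) ≤ σ → N (b +ᶜ ι τ *ᶜ (v +ᶜ r)) < N b
    descent-step b v r {σ} {τ} 0<σ 0<τ σ+σ≈ dot≤σ N≤σ = <-from
      (*-pos 0<τ (pos+nonneg 0<σ (+-nonneg (*-nonneg (<⇒≤ 0<2) (≤-diff dot≤σ)) (≤-diff N≤σ))))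
      (trans
        (trans (+-congˡ (*-congˡ (solve 3 (λ s d n → s :+ (con (+ 2) :* (s :- d) :+ (s :- n)) := con (+ 2) :* (s :+ s) :- con (+ 2) :* d :- n) refl σ _ _)))
          (+-congˡ (*-congˡ (+-congʳ (+-congʳ (*-congˡ σ+σ≈))))))
        (solve 7 (λ t a b c d e f →
          let x = c :+ e ; y = d :+ f
              p = a :+ (t :* x :- con (+ 0) :* y)
              q = b :+ (t :* y :+ con (+ 0) :* x)
          in p :* p :+ q :* q :+ t :* (con (+ 2) :* (:- (a :* c :+ b :* d)) :- con (+ 2) :* (a :* e :+ b :* f) :-
                                       t :* (x :* x :+ y :* y)) :=
             a :* a :+ b :* b) refl τ (re b) (im b) (re v) (im v) (re r) (im r)))

  abstract

    -- One of the two factors t is given up, leaving a bound linear in t as `*-small` requires.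
    remainder-bound : ∀ A q {t C} → 0# < t → t ≤ 1# → 0# ≤ C → N q ≤ C → N (ι t *ᶜ (A *ᶜ q)) ≤ t * (N A * C)
    remainder-bound A q {t} {C} 0<t t≤1 0≤C Nq≤C = ≤-trans
      (≤-reflexive (trans (N-* (ι t) (A *ᶜ q)) (*-cong (N-ι t) (N-* A q))))
      (≤-from (+-nonneg (*-nonneg (*-nonneg (<⇒≤ 0<t) (≤-diff t≤1)) (*-nonneg (0≤N A) 0≤C))
          (*-nonneg (*-nonneg (<⇒≤ 0<t) (<⇒≤ 0<t)) (*-nonneg (0≤N A) (≤-diff Nq≤C))))
        (solve 4 (λ a q t C → t :* t :* (a :* q) :+ (t :* (con (+ 1) :- t) :* (a :* C) :+ t :* t :* (a :* (C :- q))) := t :* (a :* C))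
          refl (N A) (N q) t C))

    N-shrink : ∀ u {t} → 0# < t → t ≤ 1# → N (ι t *ᶜ u) ≤ N u
    N-shrink u {t} 0<t t≤1 = ≤-trans (≤-reflexive (trans (N-* (ι t) u) (*-congʳ (N-ι t))))
      (≤-from (*-nonneg (+-nonneg (*-nonneg (<⇒≤ 0<t) (≤-diff t≤1)) (≤-diff t≤1)) (0≤N u))
        (solve 2 (λ t n → t :* t :* n :+ (t :* (con (+ 1) :- t) :+ (con (+ 1) :- t)) :* n := n) refl t (N u)))

    -- The first smallness condition bounds `dot b r` by σ through Cauchy-Schwarz; the second bounds
    -- τ N (v + r), using N (v + r) ≤ 2(N v + B).
    descent-bound : ∀ b v r {σ t τ B} → 0# < σ → σ + σ ≈ - dot b v → 0# < τ → τ ≤ t → t ≤ 1# → 0# ≤ B →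
      N r ≤ t * B → N b * B * t ≤ σ * σ → 2# * (N v + B) * t ≤ σ →
      N (b +ᶜ ι τ *ᶜ (v +ᶜ r)) < N b
    descent-bound b v r {σ} {t} {τ} {B} 0<σ σ+σ≈ 0<τ τ≤t t≤1 0≤B Nr≤tB small₁ small₂ =
      descent-step b v r 0<σ 0<τ σ+σ≈
        (cauchy-schwarz b r (<⇒≤ 0<σ) (≤-trans
          (≤-from (*-nonneg (0≤N b) (≤-diff Nr≤tB))
            (solve 4 (λ n r t B → n :* r :+ n :* (t :* B :- r) := n :* B :* t) refl (N b) (N r) t B))
          small₁))
        (≤-trans
          (≤-from (+-nonneg (+-nonneg
              (*-nonneg (<⇒≤ 0<τ) (≤-diff (N-+ v r)))
              (*-nonneg (<⇒≤ 0<τ) (*-nonneg (<⇒≤ 0<2) (+-nonneg (≤-diff Nr≤tB) (*-nonneg (≤-diff t≤1) 0≤B)))))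
              (*-nonneg (≤-diff τ≤t) (*-nonneg (<⇒≤ 0<2) (+-nonneg (0≤N v) 0≤B))))
            (solve 6 (λ n v r t τ B →
              τ :* n :+ (τ :* (con (+ 2) :* (v :+ r) :- n) :+
                         τ :* (con (+ 2) :* (t :* B :- r :+ (con (+ 1) :- t) :* B)) :+
                         (t :- τ) :* (con (+ 2) :* (v :+ B))) :=
              con (+ 2) :* (v :+ B) :* t) refl (N (v +ᶜ r)) (N v) (N r) t τ B))
          small₂)

    -- With h = t u the power t^(k+1) = τ comes out, leaving the main direction c u^(k+1) and a
    -- remainder that keeps one more factor t.
    descent-expansion : ∀ b c u (q : ℂ → ℂ) k {t τ} → ι t ^ᶜ suc k ≈ᶜ ι τ → let h = ι t *ᶜ u in
      b +ᶜ h *ᶜ (h ^ᶜ k *ᶜ (c +ᶜ h *ᶜ q h)) ≈ᶜ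
      b +ᶜ ι τ *ᶜ (c *ᶜ u ^ᶜ suc k +ᶜ ι t *ᶜ (u ^ᶜ suc (suc k) *ᶜ q h))
    descent-expansion b c u q k {t} {τ} ι-pow = let h = ι t *ᶜ u in begin
      b +ᶜ h *ᶜ (h ^ᶜ k *ᶜ (c +ᶜ h *ᶜ q h))               ≈⟨ 𝐂.+-congˡ (𝐂.*-assoc h (h ^ᶜ k) _) ⟨
      b +ᶜ h ^ᶜ suc k *ᶜ (c +ᶜ h *ᶜ q h)                  ≈⟨ 𝐂.+-congˡ (𝐂.*-congʳ (𝐂.^-distrib-* (ι t) u (suc k))) ⟩
      b +ᶜ ι t ^ᶜ suc k *ᶜ u ^ᶜ suc k *ᶜ (c +ᶜ h *ᶜ q h)  ≈⟨ 𝐂.+-congˡ (𝐂.*-congʳ (𝐂.*-congʳ ι-pow)) ⟩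
      b +ᶜ ι τ *ᶜ u ^ᶜ suc k *ᶜ (c +ᶜ h *ᶜ q h)           ≈⟨ 𝐂.solve 7 (λ b τ U c t u q →
        b 𝐂.:+ τ 𝐂.:* U 𝐂.:* (c 𝐂.:+ t 𝐂.:* u 𝐂.:* q) 𝐂.:=
        b 𝐂.:+ τ 𝐂.:* (c 𝐂.:* U 𝐂.:+ t 𝐂.:* (u 𝐂.:* U 𝐂.:* q))) 𝐂.refl b (ι τ) (u ^ᶜ suc k) c (ι t) u (q h) ⟩
      b +ᶜ ι τ *ᶜ (c *ᶜ u ^ᶜ suc k +ᶜ ι t *ᶜ (u ^ᶜ suc (suc k) *ᶜ q h)) ∎
      where open SetoidReasoning 𝐂.setoid

    -- A small multiple h = t u does it: t ≤ 1 keeps h in the disc where `q` is bounded, and t is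
    -- taken small enough for both conditions of `descent-bound`.
    descent-along : ∀ b c u (q : ℂ → ℂ) k {C σ} → 0# < σ → σ + σ ≈ - dot b (c *ᶜ u ^ᶜ suc k) →
      0# ≤ C → (∀ h → N h ≤ N u → N (q h) ≤ C) →
      ∃ λ h → N (b +ᶜ h *ᶜ (h ^ᶜ k *ᶜ (c +ᶜ h *ᶜ q h))) < N b
    descent-along b c u q k {C} {σ} 0<σ σ+σ≈ 0≤C bound =
      let v = c *ᶜ u ^ᶜ suc k
          A = u ^ᶜ suc (suc k)
          0≤B = *-nonneg (0≤N A) 0≤C
          δ₁ , 0<δ₁ , δ₁≤1 , small₁ = *-small (*-nonneg (0≤N b) 0≤B) (*-pos 0<σ 0<σ)
          δ₂ , 0<δ₂ , _ , small₂ = *-small (*-nonneg (<⇒≤ 0<2) (+-nonneg (0≤N v) 0≤B)) 0<σ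
          t , 0<t , t≤δ₁ , t≤δ₂ = lower 0<δ₁ 0<δ₂
      in at 0<t (≤-trans t≤δ₁ δ₁≤1) (small₁ t≤δ₁) (small₂ t≤δ₂)
      where
      at : ∀ {t} → 0# < t → t ≤ 1# → N b * (N (u ^ᶜ suc (suc k)) * C) * t ≤ σ * σ →
        2# * (N (c *ᶜ u ^ᶜ suc k) + N (u ^ᶜ suc (suc k)) * C) * t ≤ σ →
        ∃ λ h → N (b +ᶜ h *ᶜ (h ^ᶜ k *ᶜ (c +ᶜ h *ᶜ q h))) < N b
      at {t} 0<t t≤1 small₁ small₂ =
        let A = u ^ᶜ suc (suc k)
            τ , 0<τ , τ≤t , ι-pow = ι-^-suc k 0<t t≤1
            h = ι t *ᶜ u
        in h , <-respˡ (sym (N-cong (descent-expansion b c u q k ι-pow)))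
             (descent-bound b _ _ 0<σ σ+σ≈ 0<τ τ≤t t≤1 (*-nonneg (0≤N A) 0≤C)
               (remainder-bound A (q h) 0<t t≤1 0≤C (bound h (N-shrink u 0<t t≤1))) small₁ small₂)

    -- `dot b v` is the real part of `conj b *ᶜ v`, so `direction` is applied to `conj b *ᶜ c`.
    descent-direction : ∀ {b c} k → ¬ (b ≈ᶜ 0ᶜ) → ¬ (c ≈ᶜ 0ᶜ) → ∃ λ u → 0# < - dot b (c *ᶜ u ^ᶜ suc k)
    descent-direction {b} {c} k b≉0 c≉0 =
      let u , neg = direction (suc k) ℕ.z<s (*-≉0 conj≉0 c≉0)
      in u , <-respʳ (solve 6 (λ a b c d e f →
               :- ((a :* c :- (:- b) :* d) :* e :- (a :* d :+ (:- b) :* c) :* f) :=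
               :- (a :* (c :* e :- d :* f) :+ b :* (c :* f :+ d :* e)))
             refl (re b) (im b) (re c) (im c) (re (u ^ᶜ suc k)) (im (u ^ᶜ suc k))) (neg⇒pos neg)
      where
      conj≉0 : ¬ (conj b ≈ᶜ 0ᶜ)
      conj≉0 (p , q) = b≉0 (p , trans (solve 1 (λ x → x := :- :- x) refl _)
        (trans (-‿cong q) (solve 0 (:- con (+ 0) := con (+ 0)) refl)))

  abstract

    descent : ∀ b D → ¬ (b 0 ≈ᶜ 0ᶜ) → Nonzero (b ∘ suc) D → ∃ λ h → N (poly b (suc D) h) < N (b 0)
    descent b D b≉0 nz =
      let k , a , E , c≉0 , factor = lowest-term (b ∘ suc) D nz
          u , 0<-dot = descent-direction k b≉0 c≉0
          σ , 0<σ , σ+σ≈ = halve 0<-dot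
          C , 0≤C , bound = bounded (a ∘ suc) E (0≤N u)
          h , less = descent-along (b 0) (a 0) u (poly (a ∘ suc) E) k 0<σ σ+σ≈ 0≤C bound
      in h , <-respˡ (sym (N-cong (𝐂.+-congˡ (𝐂.*-congˡ (factor h))))) less

    -- Obtained as the supremum of the lower bounds, since completeness speaks of suprema.
    infimum : (F : ℂ → ℝ) → (∀ z → 0# ≤ F z) →
      ∃ λ m → (∀ z → m ≤ F z) × (∀ m′ → (∀ z → m′ ≤ F z) → m′ ≤ m)
    infimum F 0≤F =
      let m , above , least = complete (λ x → ∀ z → x ≤ F z) (0# , 0≤F) (F 0ᶜ , λ x x≤F → x≤F 0ᶜ)
      in m , (λ z → least (F z) (λ x x≤F → x≤F z)) , above

    large-square : ∀ ρ → ∃ λ x → 1# ≤ x × (∀ {y} → x ≤ y → ρ ≤ y * y)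
    large-square ρ =
      let x , ρ≤x , 1≤x = upper ρ 1#
      in x , 1≤x , λ {y} x≤y → let 1≤y = ≤-trans 1≤x x≤y in ≤-trans ρ≤x (≤-trans x≤y
           (≤-from (*-nonneg (≤-diff 1≤y) (≤-trans 0≤1 1≤y)) (solve 1 (λ y → y :+ (y :- con (+ 1)) :* y := y :* y) refl y)))

    near⇒square≤ : ∀ {x x₀ η} → x₀ - η ≤ x → x ≤ x₀ + η → (x - x₀) * (x - x₀) ≤ η * η
    near⇒square≤ {x} {x₀} {η} lo hi = ≤-from (*-nonneg (≤-diff lo) (≤-diff hi))
      (solve 3 (λ x y η → (x :- y) :* (x :- y) :+ (x :- (y :- η)) :* (y :+ η :- x) := η :* η) refl x x₀ η)

  -- Cousin's lemma along a vertical line makes the bound uniform on a strip around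
  -- it; applied again across the strips, it makes the bound uniform on the square.

  LocallyAbove : ℝ → (ℂ → ℝ) → Set
  LocallyAbove m F = ∀ x₀ y₀ → ∃ λ ε → ∃ λ η → 0# < ε × 0# < η ×
    (∀ {x y} → x₀ - η ≤ x → x ≤ x₀ + η → y₀ - η ≤ y → y ≤ y₀ + η → m + ε ≤ F (x +i y))

  abstract

    +-monoʳ-≤ : ∀ m {x y} → x ≤ y → m + x ≤ m + y
    +-monoʳ-≤ m {x} {y} x≤y = ≤-from (≤-diff x≤y) (solve 3 (λ m x y → m :+ x :+ (y :- x) := m :+ y) refl m x y)

    -‿mono-≤ : ∀ m {x y} → x ≤ y → m - y ≤ m - x
    -‿mono-≤ m {x} {y} x≤y = ≤-from (≤-diff x≤y) (solve 3 (λ m x y → m :- y :+ (y :- x) := m :- x) refl m x y)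

    locallyAbove⇒above : ∀ {m F} → LocallyAbove m F → ∀ {c d} → c ≤ d → ¬ ¬ ∃ λ ε → 0# < ε ×
      (∀ {x y} → c ≤ x → x ≤ d → c ≤ y → y ≤ d → m + ε ≤ F (x +i y))
    locallyAbove⇒above {m} {F} local {c} {d} c≤d = cousin Q Q-join
      (λ x₀ → ¬¬-map (Q-local x₀) (cousin (Strip x₀) (Strip-join x₀) (Strip-local x₀) c≤d)) c≤d
      where
      Q : ℝ → ℝ → Set
      Q u v = ∃ λ ε → 0# < ε × (∀ {x y} → u ≤ x → x ≤ v → c ≤ y → y ≤ d → m + ε ≤ F (x +i y))
      Q-join : ∀ {u v w} → Q u v → Q v w → Q u w
      Q-join {v = v} (ε₁ , 0<ε₁ , above₁) (ε₂ , 0<ε₂ , above₂) =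
        let ε , 0<ε , ε≤ε₁ , ε≤ε₂ = lower 0<ε₁ 0<ε₂
            cases : ∀ {x y} → x ≤ v ⊎ v < x → _ → _ → _ → _ → m + ε ≤ F (x +i y)
            cases = λ { (inj₁ x≤v) u≤x x≤w c≤y y≤d → ≤-trans (+-monoʳ-≤ m ε≤ε₁) (above₁ u≤x x≤v c≤y y≤d)
                      ; (inj₂ v<x) u≤x x≤w c≤y y≤d → ≤-trans (+-monoʳ-≤ m ε≤ε₂) (above₂ (<⇒≤ v<x) x≤w c≤y y≤d) }
        in ε , 0<ε , λ {x} → cases (≤-<-connex x v)
      Strip : ℝ → ℝ → ℝ → Set
      Strip x₀ u v = ∃ λ ε → ∃ λ δ → 0# < ε × 0# < δ ×
        (∀ {x y} → x₀ - δ ≤ x → x ≤ x₀ + δ → u ≤ y → y ≤ v → m + ε ≤ F (x +i y))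
      Strip-join : ∀ x₀ {u v w} → Strip x₀ u v → Strip x₀ v w → Strip x₀ u w
      Strip-join x₀ {v = v} (ε₁ , δ₁ , 0<ε₁ , 0<δ₁ , above₁) (ε₂ , δ₂ , 0<ε₂ , 0<δ₂ , above₂) =
        let ε , 0<ε , ε≤ε₁ , ε≤ε₂ = lower 0<ε₁ 0<ε₂
            δ , 0<δ , δ≤δ₁ , δ≤δ₂ = lower 0<δ₁ 0<δ₂
            cases : ∀ {x y} → y ≤ v ⊎ v < y → _ → _ → _ → _ → m + ε ≤ F (x +i y)
            cases = λ
              { (inj₁ y≤v) lo hi u≤y y≤w → ≤-trans (+-monoʳ-≤ m ε≤ε₁)
                  (above₁ (≤-trans (-‿mono-≤ x₀ δ≤δ₁) lo) (≤-trans hi (+-monoʳ-≤ x₀ δ≤δ₁)) u≤y y≤v)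
              ; (inj₂ v<y) lo hi u≤y y≤w → ≤-trans (+-monoʳ-≤ m ε≤ε₂)
                  (above₂ (≤-trans (-‿mono-≤ x₀ δ≤δ₂) lo) (≤-trans hi (+-monoʳ-≤ x₀ δ≤δ₂)) (<⇒≤ v<y) y≤w) }
        in ε , δ , 0<ε , 0<δ , λ {x} {y} → cases (≤-<-connex y v)
      Q-local : ∀ x₀ → Strip x₀ c d → ∃ λ δ → 0# < δ × (∀ {u v} → x₀ - δ ≤ u → u ≤ v → v ≤ x₀ + δ → Q u v)
      Q-local x₀ (ε , δ , 0<ε , 0<δ , above) = δ , 0<δ , λ lo _ hi →
        ε , 0<ε , λ u≤x x≤v c≤y y≤d → above (≤-trans lo u≤x) (≤-trans x≤v hi) c≤y y≤d
      Strip-local : ∀ x₀ y₀ → ¬ ¬ ∃ λ δ → 0# < δ × (∀ {u v} → y₀ - δ ≤ u → u ≤ v → v ≤ y₀ + δ → Strip x₀ u v)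
      Strip-local x₀ y₀ k =
        let ε , η , 0<ε , 0<η , above = local x₀ y₀
        in k (η , 0<η , λ lo _ hi → ε , η , 0<ε , 0<η , λ x-lo x-hi u≤y y≤v →
               above x-lo x-hi (≤-trans lo u≤y) (≤-trans y≤v hi))

    rootless⇒not-minimal : ∀ a D → (∀ z → ¬ (poly a (suc D) z ≈ᶜ 0ᶜ)) → Nonzero (a ∘ suc) D →
      ∀ z₀ → ∃ λ z → N (poly a (suc D) z) < N (poly a (suc D) z₀)
    rootless⇒not-minimal a D rootless nz z₀ =
      let b , expand = taylor a (suc D) z₀
          p = poly a (suc D)
          pz₀≈b0 = 𝐂.trans (poly-congʳ a (suc D) (𝐂.sym (𝐂.+-identityʳ z₀)))
            (𝐂.trans (expand 0ᶜ) (𝐂.trans (𝐂.+-congˡ (𝐂.zeroˡ _)) (𝐂.+-identityʳ (b 0))))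
          constant⇒⊥ : AllZero (b ∘ suc) D → ⊥
          constant⇒⊥ zeros =
            -- That the expansion about z₀ is not constant is read off from growth at infinity, not
            -- from a formula for its coefficients.
            let ρ , grow = nonconstant⇒grows a D nz (N (b 0) + 1#)
                x , _ , ρ≤xx = large-square ρ
                z = ι x
                shift = 𝐂.solve 2 (λ z z₀ → z 𝐂.:= z₀ 𝐂.:+ (z 𝐂.:+ 𝐂.:- z₀)) 𝐂.refl z z₀
                pz≈b0 = 𝐂.trans (poly-congʳ a (suc D) shift) (𝐂.trans (expand _) (poly-constant b D _ zeros))
            in ≤⇒≯ (≤-trans (grow z (≤-trans (ρ≤xx ≤-refl) (≤-reflexive (sym (N-ι x))))) (≤-reflexive (N-cong pz≈b0)))
                 (<-from 0<1 refl)
          cases : Nonzero (b ∘ suc) D ⊎ AllZero (b ∘ suc) D → ∃ λ z → N (p z) < N (p z₀)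
          cases = λ
            { (inj₁ nz′) → let h , less = descent b D (λ b0≈0 → rootless z₀ (𝐂.trans pz₀≈b0 b0≈0)) nz′
                           in z₀ +ᶜ h , <-respʳ (sym (N-cong pz₀≈b0)) (<-respˡ (sym (N-cong (expand h))) less)
            ; (inj₂ zeros) → ⊥-elim (constant⇒⊥ zeros) }
      in cases (nonzero? (b ∘ suc) D)

    poly-locallyAbove : ∀ a D {m} → (∀ z → m < N (poly a (suc D) z)) → LocallyAbove m (λ z → N (poly a (suc D) z))
    poly-locallyAbove a D {m} m<N x₀ y₀ =
      let z₀ = x₀ +i y₀
          b , expand = taylor a (suc D) z₀
          pz₀≈b0 = 𝐂.trans (poly-congʳ a (suc D) (𝐂.sym (𝐂.+-identityʳ z₀)))
            (𝐂.trans (expand 0ᶜ) (𝐂.trans (𝐂.+-congˡ (𝐂.zeroˡ _)) (𝐂.+-identityʳ (b 0))))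
          ε , δ , 0<ε , 0<δ , above = lower-semicontinuous b D (<-respʳ (N-cong pz₀≈b0) (m<N z₀))
          -- On the square of half side η about z₀, N h ≤ 2η² ≤ 2η ≤ δ.
          η , 0<η , η≤1 , small = *-small (<⇒≤ 0<2) 0<δ
      in ε , η , 0<ε , 0<η , λ {x} {y} x-lo x-hi y-lo y-hi →
        let h = (x - x₀) +i (y - y₀)
            Nh≤δ = ≤-trans
              (≤-from (+-nonneg (+-nonneg (≤-diff (near⇒square≤ x-lo x-hi)) (≤-diff (near⇒square≤ y-lo y-hi)))
                        (*-nonneg (<⇒≤ 0<2) (*-nonneg (<⇒≤ 0<η) (≤-diff η≤1))))
                (solve 3 (λ x y η → x :+ y :+ (η :* η :- x :+ (η :* η :- y) :+ con (+ 2) :* (η :* (con (+ 1) :- η))) := con (+ 2) :* η)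
                  refl _ _ η))
              (small ≤-refl)
            shift = solve 2 (λ x x₀ → x₀ :+ (x :- x₀) := x) refl x x₀ , solve 2 (λ x x₀ → x₀ :+ (x :- x₀) := x) refl y y₀
        in ≤-trans (above h Nh≤δ) (≤-reflexive (N-cong (𝐂.trans (𝐂.sym (expand h)) (poly-congʳ a (suc D) shift))))

    -- Without a root the infimum m lies strictly below every value. Compactness gives a margin ε on
    -- a large square and growth gives a margin 1 outside it, so m would not be the greatest lower
    -- bound.
    fundamental-theorem-of-algebra : ∀ a D → Nonzero (a ∘ suc) D → ¬ (∀ z → ¬ (poly a (suc D) z ≈ᶜ 0ᶜ))
    fundamental-theorem-of-algebra a D nz rootless =
      let F = λ z → N (poly a (suc D) z)
          m , m≤F , greatest = infimum F (λ z → 0≤N _)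
          m<F : ∀ z → m < F z
          m<F z = let w , Fw<Fz = rootless⇒not-minimal a D rootless nz z in ≤-<-trans (m≤F w) Fw<Fz
          ρ , grow = nonconstant⇒grows a D nz (m + 1#)
          x₁ , 1≤x₁ , ρ≤xx = large-square ρ
          0≤x₁ = ≤-trans 0≤1 1≤x₁
          -x₁≤x₁ = ≤-from (+-nonneg 0≤x₁ 0≤x₁) (solve 1 (λ x → :- x :+ (x :+ x) := x) refl x₁)
          ρ≤-xx : ∀ {x} → x < - x₁ → ρ ≤ x * x
          ρ≤-xx {x} x<-x₁ = ≤-trans
            (ρ≤xx { - x } (≤-from (<⇒≤ (<-diff x<-x₁)) (solve 2 (λ x y → y :+ (:- y :- x) := :- x) refl x x₁)))
            (≤-reflexive (solve 1 (λ x → (:- x) :* (:- x) := x :* x) refl x))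
      in locallyAbove⇒above (poly-locallyAbove a D m<F) -x₁≤x₁ λ (ε , 0<ε , inside) →
        let η , 0<η , η≤ε , η≤1 = lower 0<ε 0<1
            far : ∀ z → ρ ≤ re z * re z ⊎ ρ ≤ im z * im z → m + η ≤ F z
            far = λ { z (inj₁ large) → ≤-trans (+-monoʳ-≤ m η≤1) (grow z (≤-trans large (≤-from (0≤x*x (im z)) refl)))
                    ; z (inj₂ large) → ≤-trans (+-monoʳ-≤ m η≤1) (grow z (≤-trans large (≤-from (0≤x*x (re z)) (+-comm _ _)))) }
            cases : ∀ z → (- x₁ ≤ re z ⊎ re z < - x₁) → (re z ≤ x₁ ⊎ x₁ < re z) →
              (- x₁ ≤ im z ⊎ im z < - x₁) → (im z ≤ x₁ ⊎ x₁ < im z) → m + η ≤ F z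
            cases = λ
              { z (inj₂ lt) _ _ _ → far z (inj₁ (ρ≤-xx lt))
              ; z _ (inj₂ lt) _ _ → far z (inj₁ (ρ≤xx (<⇒≤ lt)))
              ; z _ _ (inj₂ lt) _ → far z (inj₂ (ρ≤-xx lt))
              ; z _ _ _ (inj₂ lt) → far z (inj₂ (ρ≤xx (<⇒≤ lt)))
              ; z (inj₁ p) (inj₁ q) (inj₁ r) (inj₁ s) → ≤-trans (+-monoʳ-≤ m η≤ε) (inside p q r s) }
        in ≤⇒≯ (greatest (m + η) λ z → cases z (≤-<-connex _ _) (≤-<-connex _ _) (≤-<-connex _ _) (≤-<-connex _ _))
             (<-from 0<η refl)

-- Finite sums and positive definiteness of a matrix that is diagonal outside one 2 × 2 block.

module QuadraticForms (R : CompleteOrderedField) where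

  open OrderedField R

  open PsdStability R
  open CompleteOrderedField R renaming (Carrier to ℝ; zero to *-zero)
  open IntegerSolver commutativeRing
  open import Algebra.Properties.CommutativeMonoid.Sum +-commutativeMonoid using (sum; sum-cong-≋; ∑-distrib-+)

  sum-zero : ∀ {n} {f : Fin n → ℝ} → (∀ i → f i ≈ 0#) → sum f ≈ 0#
  sum-zero {zero}  f≈0 = refl
  sum-zero {suc n} f≈0 = trans (+-cong (f≈0 zero) (sum-zero (f≈0 ∘ suc))) (+-identityˡ 0#)

  sum-single : ∀ {n} {f : Fin n → ℝ} i → (∀ j → j ≢ i → f j ≈ 0#) → sum f ≈ f i
  sum-single zero    f≈0 = trans (+-congˡ (sum-zero λ j → f≈0 (suc j) λ ())) (+-identityʳ _)
  sum-single (suc i) f≈0 = trans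
    (+-cong (f≈0 zero λ ()) (sum-single i λ j j≢i → f≈0 (suc j) (j≢i ∘ Fin.suc-injective))) (+-identityˡ _)

  sum-pair : ∀ {n} {f : Fin n → ℝ} i j → i ≢ j → (∀ k → k ≢ i → k ≢ j → f k ≈ 0#) → sum f ≈ f i + f j
  sum-pair zero    zero    i≢j f≈0 = ⊥-elim (i≢j ≡.refl)
  sum-pair zero    (suc j) i≢j f≈0 =
    +-congˡ (sum-single j λ k k≢j → f≈0 (suc k) (λ ()) (k≢j ∘ Fin.suc-injective))
  sum-pair (suc i) zero    i≢j f≈0 =
    trans (+-congˡ (sum-single i λ k k≢i → f≈0 (suc k) (k≢i ∘ Fin.suc-injective) λ ())) (+-comm _ _)
  sum-pair (suc i) (suc j) i≢j f≈0 = trans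
    (+-cong (f≈0 zero (λ ()) (λ ())) (sum-pair i j (i≢j ∘ ≡.cong suc) λ k k≢i k≢j →
      f≈0 (suc k) (k≢i ∘ Fin.suc-injective) (k≢j ∘ Fin.suc-injective)))
    (+-identityˡ _)

  sum-nonneg : ∀ {n} {f : Fin n → ℝ} → (∀ i → 0# ≤ f i) → 0# ≤ sum f
  sum-nonneg {zero}  0≤f = ≤-refl
  sum-nonneg {suc n} 0≤f = +-nonneg (0≤f zero) (sum-nonneg (0≤f ∘ suc))

  sum-pos : ∀ {n} {f : Fin n → ℝ} → (∀ i → 0# ≤ f i) → ∀ i → 0# < f i → 0# < sum f
  sum-pos 0≤f zero    0<fi = pos+nonneg 0<fi (sum-nonneg (0≤f ∘ suc))
  sum-pos 0≤f (suc i) 0<fi = nonneg+pos (0≤f zero) (sum-pos (0≤f ∘ suc) i 0<fi)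

  module _ {n} {k l : Fin n} (k≢l : k ≢ l) where

    onPair offPair : (Fin n → ℝ) → Fin n → ℝ
    onPair f i with i Fin.≟ k | i Fin.≟ l
    ... | no _ | no _ = 0#
    ... | _    | _    = f i
    offPair f i with i Fin.≟ k | i Fin.≟ l
    ... | no _ | no _ = f i
    ... | _    | _    = 0#

    onPair+offPair : ∀ f i → f i ≈ onPair f i + offPair f i
    onPair+offPair f i with i Fin.≟ k | i Fin.≟ l
    ... | no _  | no _  = sym (+-identityˡ _)
    ... | yes _ | _     = sym (+-identityʳ _)
    ... | no _  | yes _ = sym (+-identityʳ _)

    onPair-off : ∀ f i → i ≢ k → i ≢ l → onPair f i ≈ 0#
    onPair-off f i i≢k i≢l with i Fin.≟ k | i Fin.≟ l
    ... | no _    | no _    = refl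
    ... | yes i≡k | _       = ⊥-elim (i≢k i≡k)
    ... | no _    | yes i≡l = ⊥-elim (i≢l i≡l)

    onPair-k : ∀ f → onPair f k ≈ f k
    onPair-k f with k Fin.≟ k | k Fin.≟ l
    ... | yes _  | _ = refl
    ... | no k≢k | _ = ⊥-elim (k≢k ≡.refl)

    onPair-l : ∀ f → onPair f l ≈ f l
    onPair-l f with l Fin.≟ k | l Fin.≟ l
    ... | yes _ | _      = refl
    ... | no _  | yes _  = refl
    ... | no _  | no l≢l = ⊥-elim (l≢l ≡.refl)

    offPair-off : ∀ f i → i ≢ k → i ≢ l → offPair f i ≈ f i
    offPair-off f i i≢k i≢l with i Fin.≟ k | i Fin.≟ l
    ... | no _    | no _    = refl
    ... | yes i≡k | _       = ⊥-elim (i≢k i≡k)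
    ... | no _    | yes i≡l = ⊥-elim (i≢l i≡l)

    offPair-nonneg : ∀ {f} → (∀ i → i ≢ k → i ≢ l → 0# ≤ f i) → ∀ i → 0# ≤ offPair f i
    offPair-nonneg 0≤f i with i Fin.≟ k | i Fin.≟ l
    ... | no i≢k | no i≢l = 0≤f i i≢k i≢l
    ... | yes _  | _      = ≤-refl
    ... | no _   | yes _  = ≤-refl

    sum-split : ∀ f → sum f ≈ (f k + f l) + sum (offPair f)
    sum-split f = trans (sum-cong-≋ (onPair+offPair f)) (trans (∑-distrib-+ (onPair f) (offPair f))
      (+-congʳ (trans (sum-pair k l k≢l (onPair-off f)) (+-cong (onPair-k f) (onPair-l f)))))

    -- A k k and A l l being positive, completing the square needs only that the
    -- 2 × 2 block in rows k and l has determinant 1.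

    block-positiveDefinite : ∀ (A : Matrix ℝ n) {y} → (∀ i → 0# < A i i) →
      (∀ i j → i ≢ j → ¬ (i ≡ k × j ≡ l) → ¬ (i ≡ l × j ≡ k) → A i j ≈ 0#) →
      A k l ≈ y → A l k ≈ y → A k k * A l l ≈ y * y + 1# → PositiveDefinite A
    block-positiveDefinite A {y} 0<A A≈0 Akl≈y Alk≈y det x x≢0 =
      <-respʳ (sym (trans (sum-split row-sum) (+-congʳ (+-cong row-k row-l)))) positive
      where
      row-sum : Fin n → ℝ
      row-sum i = sum λ j → x i * A i j * x j
      zero-term : ∀ {i j} → A i j ≈ 0# → x i * A i j * x j ≈ 0#
      zero-term A≈0 = trans (*-congʳ (trans (*-congˡ A≈0) (zeroʳ _))) (zeroˡ _)
      xk = x k ; xl = x l ; akk = A k k ; all = A l l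
      form : ℝ
      form = (xk * akk * xk + xk * y * xl) + (xl * all * xl + xl * y * xk)
      row-k : row-sum k ≈ xk * akk * xk + xk * y * xl
      row-k = trans (sum-pair k l k≢l λ j j≢k j≢l →
          zero-term (A≈0 k j (j≢k ∘ ≡.sym) (j≢l ∘ proj₂) (k≢l ∘ proj₁)))
        (+-congˡ (*-congʳ (*-congˡ Akl≈y)))
      row-l : row-sum l ≈ xl * all * xl + xl * y * xk
      row-l = trans (sum-pair l k (k≢l ∘ ≡.sym) λ j j≢l j≢k →
          zero-term (A≈0 l j (j≢l ∘ ≡.sym) (k≢l ∘ ≡.sym ∘ proj₁) (j≢k ∘ proj₂)))
        (+-congˡ (*-congʳ (*-congˡ Alk≈y)))
      row-i : ∀ i → i ≢ k → i ≢ l → row-sum i ≈ A i i * (x i * x i)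
      row-i i i≢k i≢l = trans
        (sum-single i λ j j≢i → zero-term (A≈0 i j (j≢i ∘ ≡.sym) (i≢k ∘ proj₁) (i≢l ∘ proj₁)))
        (solve 2 (λ x a → x :* a :* x := a :* (x :* x)) refl (x i) (A i i))
      -- Multiplying by the diagonal entry replaces a division, and determinant 1 leaves exactly
      -- xk². The twin `akk*form` leaves xl² and serves when xk is zero.
      all*form : all * form ≈ (all * xl + y * xk) * (all * xl + y * xk) + xk * xk
      all*form = trans
        (solve 5 (λ a b u v y → b :* ((u :* a :* u :+ u :* y :* v) :+ (v :* b :* v :+ v :* y :* u)) :=
          (b :* v :+ y :* u) :* (b :* v :+ y :* u) :+ (a :* b :- y :* y) :* (u :* u)) refl akk all xk xl y)
        (+-congˡ (trans (*-congʳ (trans (+-congʳ det) (solve 1 (λ x → x :+ con (+ 1) :- x := con (+ 1)) refl (y * y)))) (*-identityˡ _)))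
      akk*form : akk * form ≈ (akk * xk + y * xl) * (akk * xk + y * xl) + xl * xl
      akk*form = trans
        (solve 5 (λ a b u v y → a :* ((u :* a :* u :+ u :* y :* v) :+ (v :* b :* v :+ v :* y :* u)) :=
          (a :* u :+ y :* v) :* (a :* u :+ y :* v) :+ (a :* b :- y :* y) :* (v :* v)) refl akk all xk xl y)
        (+-congˡ (trans (*-congʳ (trans (+-congʳ det) (solve 1 (λ x → x :+ con (+ 1) :- x := con (+ 1)) refl (y * y)))) (*-identityˡ _)))
      0≤form : 0# ≤ form
      0≤form = *-pos-cancelˡ-≤ (0<A l) (≤-trans (≤-reflexive (zeroʳ all))
        (≤-trans (+-nonneg (0≤x*x _) (0≤x*x xk)) (≤-reflexive (sym all*form))))
      0≤row : ∀ i → i ≢ k → i ≢ l → 0# ≤ row-sum i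
      0≤row i i≢k i≢l = ≤-trans (*-nonneg (<⇒≤ (0<A i)) (0≤x*x (x i))) (≤-reflexive (sym (row-i i i≢k i≢l)))
      positive : 0# < form + sum (offPair row-sum)
      -- Strict positivity comes from the block if xk or xl is nonzero, and otherwise from the row
      -- of another nonzero coordinate.
      positive with xk ≟ 0# | xl ≟ 0#
      ... | no xk≉0 | _ = pos+nonneg
        (pos-cancelˡ (<⇒≤ (0<A l)) (<-respʳ (sym all*form) (nonneg+pos (0≤x*x _) (≉0⇒0<x*x xk≉0))))
        (sum-nonneg (offPair-nonneg 0≤row))
      ... | yes _ | no xl≉0 = pos+nonneg
        (pos-cancelˡ (<⇒≤ (0<A k)) (<-respʳ (sym akk*form) (nonneg+pos (0≤x*x _) (≉0⇒0<x*x xl≉0))))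
        (sum-nonneg (offPair-nonneg 0≤row))
      ... | yes xk≈0 | yes xl≈0 =
        let i , xi≉0 = Fin.¬∀⟶∃¬ n (λ i → x i ≈ 0#) (λ i → x i ≟ 0#) x≢0
            i≢k = λ (i≡k : i ≡ k) → xi≉0 (trans (reflexive (≡.cong x i≡k)) xk≈0)
            i≢l = λ (i≡l : i ≡ l) → xi≉0 (trans (reflexive (≡.cong x i≡l)) xl≈0)
        in nonneg+pos 0≤form (sum-pos (offPair-nonneg 0≤row) i (<-respʳ
             (sym (trans (offPair-off row-sum i i≢k i≢l) (row-i i i≢k i≢l)))
             (*-pos (0<A i) (≉0⇒0<x*x xi≉0))))

-- Enumeration of the variables, and access to them by unordered positions.

module Variables where

  infix 4 _≟ᵛ_
  _≟ᵛ_ : ∀ {n} → DecidableEquality (Variable n)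
  _≟ᵛ_ = ≡-dec Fin._≟_ Fin._≟_

  column : ∀ {n} → Fin n → List (Variable n)
  column j = tabulate λ i → j , i

  variables : ∀ n → List (Variable n)
  variables n = concat (tabulate column)

  ∈-variables : ∀ {n} (v : Variable n) → v ∈ variables n
  ∈-variables (j , i) = ∈-concat⁺′ (∈-tabulate⁺ {f = λ i → j , i} i) (∈-tabulate⁺ {f = column} j)

  variables-unique : ∀ n → Unique (variables n)
  variables-unique n = Unique.concat⁺
    (All.tabulate⁺ {f = column} λ j → Unique.tabulate⁺ {f = λ i → j , i} λ { ≡.refl → ≡.refl })
    (AllPairs.tabulate⁺ {f = column} λ {j} {j′} j≢j′ (v∈ , v∈′) →
      j≢j′ (same (∈-tabulate⁻ {f = λ i → j , i} v∈) (∈-tabulate⁻ {f = λ i → j′ , i} v∈′)))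
    where
    same : ∀ {j j′} {v : Variable n} → (∃ λ i → v ≡ (j , i)) → (∃ λ i → v ≡ (j′ , i)) → j ≡ j′
    same (_ , ≡.refl) (_ , ≡.refl) = ≡.refl

  module _ {A : Set} where

    ∈⇒↭ : ∀ {v : A} {vs} → v ∈ vs → ∃ λ ws → vs ↭ v ∷ ws
    ∈⇒↭ v∈vs with ∈-∃++ v∈vs
    ... | ys , zs , ≡.refl = ys ++ zs , shift _ ys zs

    ∈∈⇒↭ : ∀ {v w : A} {vs} → v ≢ w → v ∈ vs → w ∈ vs → ∃ λ us → vs ↭ v ∷ w ∷ us
    ∈∈⇒↭ v≢w v∈vs w∈vs with ∈⇒↭ v∈vs
    ... | ws , vs↭ with ∈-resp-↭ vs↭ w∈vs
    ... | here w≡v = ⊥-elim (v≢w (≡.sym w≡v))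
    ... | there w∈ws with ∈⇒↭ w∈ws
    ... | us , ws↭ = us , ↭-trans vs↭ (↭.prep _ ws↭)

    unique-↭ : ∀ {vs ws : List A} → vs ↭ ws → Unique vs → Unique ws
    unique-↭ p = Unique-resp-↭ (≡.setoid A) (↭⇒↭ₛ p)

  -- Indexing by unordered pairs makes matrices filled through `entry` symmetric and lets one
  -- argument serve both k < l and k > l.
  entry : ∀ {n} (p q : Fin n) → Variable n
  entry p q with p Fin.≤? q
  ... | yes p≤q = z p q p≤q
  ... | no  p≰q = z q p (ℕ.≰⇒≥ p≰q)

  z-cong : ∀ {n} {i j i′ j′ : Fin n} (p : i Fin.≤ j) (p′ : i′ Fin.≤ j′) →
    i ≡ i′ → j ≡ j′ → z i j p ≡ z i′ j′ p′
  z-cong p p′ ≡.refl ≡.refl = ≡.refl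

  entry-z : ∀ {n} {p q : Fin n} (p≤q : p Fin.≤ q) → entry p q ≡ z p q p≤q
  entry-z {p = p} {q} p≤q with p Fin.≤? q
  ... | yes p≤q′ = ≡.refl
  ... | no  p≰q  = ⊥-elim (p≰q p≤q)

  entry-sym : ∀ {n} (p q : Fin n) → entry p q ≡ entry q p
  entry-sym p q with p Fin.≤? q | q Fin.≤? p
  ... | yes p≤q | yes q≤p = let p≡q = Fin.≤-antisym p≤q q≤p in z-cong p≤q q≤p p≡q (≡.sym p≡q)
  ... | yes p≤q | no  q≰p = ≡.refl
  ... | no  p≰q | yes q≤p = ≡.refl
  ... | no  p≰q | no  q≰p = ⊥-elim (q≰p (ℕ.≰⇒≥ p≰q))

  toℕ-inject! : ∀ {n} {i : Fin (suc n)} (k : Fin.Fin′ i) → toℕ (inject! k) ≡ toℕ k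
  toℕ-inject! {suc n} {suc i} zero    = ≡.refl
  toℕ-inject! {suc n} {suc i} (suc k) = ≡.cong suc (toℕ-inject! k)

  toℕ-row : ∀ {n} (v : Variable n) → toℕ (row v) ≡ toℕ (proj₂ v)
  toℕ-row (j , i) = toℕ-inject! i

  row-z : ∀ {n} {p q : Fin n} (p≤q : p Fin.≤ q) → row (z p q p≤q) ≡ p
  row-z p≤q = Fin.toℕ-injective (≡.trans (toℕ-row (z _ _ p≤q)) (Fin.toℕ-fromℕ< (s≤s p≤q)))

  -- Evaluation reads a matrix at `row v` and `col v`; this recovers the value with which `v` was
  -- filled.
  entry-row-col : ∀ {n} (v : Variable n) → entry (row v) (col v) ≡ v
  entry-row-col v@(j , i) = ≡.trans (entry-z row≤col)
    (≡.cong (j ,_) (Fin.toℕ-injective (≡.trans (Fin.toℕ-fromℕ< (s≤s row≤col)) (toℕ-row v))))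
    where
    row≤col : row v Fin.≤ col v
    row≤col = ℕ.≤-trans (ℕ.≤-reflexive (toℕ-row v)) (ℕ.≤-pred (Fin.toℕ<n i))

  z-injectiveˡ : ∀ {n} {p q r s : Fin n} (p≤q : p Fin.≤ q) (r≤s : r Fin.≤ s) → z p q p≤q ≡ z r s r≤s → p ≡ r
  z-injectiveˡ p≤q r≤s eq = ≡.trans (≡.sym (row-z p≤q)) (≡.trans (≡.cong row eq) (row-z r≤s))

  entry-injective : ∀ {n} {p q r s : Fin n} → entry p q ≡ entry r s → (p ≡ r × q ≡ s) ⊎ (p ≡ s × q ≡ r)
  entry-injective {p = p} {q} {r} {s} eq with p Fin.≤? q | r Fin.≤? s
  ... | yes p≤q | yes r≤s = inj₁ (z-injectiveˡ p≤q r≤s eq , ≡.cong col eq)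
  ... | yes p≤q | no  r≰s = inj₂ (z-injectiveˡ p≤q (ℕ.≰⇒≥ r≰s) eq , ≡.cong col eq)
  ... | no  p≰q | yes r≤s = inj₂ (≡.cong col eq , z-injectiveˡ (ℕ.≰⇒≥ p≰q) r≤s eq)
  ... | no  p≰q | no  r≰s = inj₁ (≡.cong col eq , z-injectiveˡ (ℕ.≰⇒≥ p≰q) (ℕ.≰⇒≥ r≰s) eq)

-- From stability to the occurrence of the diagonal variables.

module PsdStability⇒Occurrence (R : CompleteOrderedField) where

  open OrderedField R
  open ComplexNumbers R
  open Directions R
  open ComplexPolynomials R
  open FundamentalTheorem R
  open QuadraticForms R
  open Variables

  open PsdStability R
  open CompleteOrderedField R renaming (Carrier to ℝ; zero to *-zero)
  open IntegerSolver commutativeRing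

  module _ {n : ℕ} where
    open Multivariate ℂ-commutativeRing (Variable n)
    open Substitution ℂ-commutativeRing (_≟ᵛ_ {n})

    ∏-tabulate : ∀ {k} (h : Fin k → Variable n) g → ∏ (tabulate h) g ≈ᶜ ℂ-ring.product (g ∘ h)
    ∏-tabulate {zero}  h g = 𝐂.refl
    ∏-tabulate {suc k} h g = 𝐂.*-congˡ {g (h zero)} (∏-tabulate (h ∘ suc) g)

    ∏-++ : ∀ vs ws g → ∏ (vs ++ ws) g ≈ᶜ ∏ vs g *ᶜ ∏ ws g
    ∏-++ []       ws g = 𝐂.sym (𝐂.*-identityˡ _)
    ∏-++ (v ∷ vs) ws g = 𝐂.trans (𝐂.*-congˡ {g v} (∏-++ vs ws g)) (𝐂.sym (𝐂.*-assoc (g v) _ _))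

    ∏-concat-tabulate : ∀ {k} (h : Fin k → List (Variable n)) g →
      ∏ (concat (tabulate h)) g ≈ᶜ ℂ-ring.product (λ j → ∏ (h j) g)
    ∏-concat-tabulate {zero}  h g = 𝐂.refl
    ∏-concat-tabulate {suc k} h g = 𝐂.trans (∏-++ (h zero) _ g) (𝐂.*-congˡ {∏ (h zero) g} (∏-concat-tabulate (h ∘ suc) g))

    product-cong : ∀ {k} {g h : Fin k → ℂ} → (∀ i → g i ≈ᶜ h i) → ℂ-ring.product g ≈ᶜ ℂ-ring.product h
    product-cong {zero}  eq = 𝐂.refl
    product-cong {suc k} eq = 𝐂.*-cong (eq zero) (product-cong (eq ∘ suc))

    evalMonomial≈ : ∀ m M → evalMonomial m M ≈ᶜ monomial (variables n) (λ v → M (row v) (col v)) m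
    evalMonomial≈ m M = 𝐂.sym (𝐂.trans (∏-concat-tabulate column g) (product-cong λ j → ∏-tabulate (j ,_) g))
      where
      g : Variable n → ℂ
      g v = M (row v) (col v) ^ᶜ m v

    eval≈ : ∀ f M → eval f M ≈ᶜ ∑ f (monomial (variables n) (λ v → M (row v) (col v)))
    eval≈ []            M = 𝐂.refl
    eval≈ ((c , m) ∷ f) M = 𝐂.+-cong (𝐂.*-congˡ {c} (evalMonomial≈ m M)) (eval≈ f M)

    indicator-≗ : ∀ vs {m₀ m} → m ≗ m₀ → indicator vs m₀ m ≈ᶜ 1ᶜ
    indicator-≗ []       m≗m₀ = 𝐂.refl
    indicator-≗ (v ∷ vs) {m₀} {m} m≗m₀ = 𝐂.trans
      (𝐂.*-cong (𝐂.trans (𝐂.reflexive (≡.cong (δ (m v)) (≡.sym (m≗m₀ v)))) (δ-diagonal (m v))) (indicator-≗ vs m≗m₀))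
      (𝐂.*-identityˡ 1ᶜ)

    indicator-differ : ∀ {vs m₀ m} → Any (λ v → m v ≢ m₀ v) vs → indicator vs m₀ m ≈ᶜ 0ᶜ
    indicator-differ {v ∷ vs} {m₀} {m} (here mv≢) =
      𝐂.trans (𝐂.*-congʳ {indicator vs m₀ m} (δ-off-diagonal (m v) (m₀ v) mv≢)) (𝐂.zeroˡ (indicator vs m₀ m))
    indicator-differ {v ∷ vs} {m₀} {m} (there differ) =
      𝐂.trans (𝐂.*-congˡ {δ (m v) (m₀ v)} (indicator-differ differ)) (𝐂.zeroʳ (δ (m v) (m₀ v)))

    indicator-≗̸ : ∀ {m₀ m} → ¬ (m ≗ m₀) → indicator (variables n) m₀ m ≈ᶜ 0ᶜ
    indicator-≗̸ {m₀} {m} m≗̸m₀ = indicator-differ (All.¬All⇒Any¬ (λ v → m v ℕ.≟ m₀ v) (variables n)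
      λ all → m≗̸m₀ λ v → All.lookup all (∈-variables v))

    -- The conditional inside `coeff`, with the decision as an argument so that it can be matched
    -- on.
    select : ∀ {m m₀ : Monomial n} → Dec (m ≗ m₀) → ℂ → ℂ
    select m≗?m₀ c = if does m≗?m₀ then c else 0ᶜ

    select≈ : ∀ {m m₀} (m≗?m₀ : Dec (m ≗ m₀)) c → select m≗?m₀ c ≈ᶜ c *ᶜ indicator (variables n) m₀ m
    select≈ (yes m≗m₀) c = 𝐂.sym (𝐂.trans (𝐂.*-congˡ {c} (indicator-≗ (variables n) m≗m₀)) (𝐂.*-identityʳ c))
    select≈ (no  m≗̸m₀) c = 𝐂.sym (𝐂.trans (𝐂.*-congˡ {c} (indicator-≗̸ m≗̸m₀)) (𝐂.zeroʳ c))

    coeff≈ : ∀ f m₀ → coeff f m₀ ≈ᶜ ∑ f (indicator (variables n) m₀)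
    coeff≈ []            m₀ = 𝐂.refl
    coeff≈ ((c , m) ∷ f) m₀ = 𝐂.+-cong (select≈ (m ≗? m₀) c) (coeff≈ f m₀)

    coeff-≗ : ∀ f {m m′} → m ≗ m′ → coeff f m ≈ᶜ coeff f m′
    coeff-≗ f {m} {m′} m≗m′ = 𝐂.trans (coeff≈ f m) (𝐂.trans
      (∑-cong f λ m″ → ∏-cong-All (All.universal (λ v → 𝐂.reflexive (≡.cong (δ (m″ v)) (m≗m′ v))) (variables n)))
      (𝐂.sym (coeff≈ f m′)))

    coeff-listed : ∀ f {m} → ¬ (coeff f m ≈ᶜ 0ᶜ) → Any (λ (_ , m′) → m′ ≗ m) f
    coeff-listed []                 nz = ⊥-elim (nz 𝐂.refl)
    coeff-listed ((c , m′) ∷ f) {m} nz = first (m′ ≗? m) nz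
      where
      first : (m′≗?m : Dec (m′ ≗ m)) → ¬ (select m′≗?m c +ᶜ coeff f m ≈ᶜ 0ᶜ) →
        Any (λ (_ , m′) → m′ ≗ m) ((c , m′) ∷ f)
      first (yes m′≗m) nz = here m′≗m
      first (no  _)    nz = there (coeff-listed f λ ≈0 → nz (𝐂.trans (𝐂.+-identityˡ (coeff f m)) ≈0))

    -- Monomials form an infinite type, but up to `≗` only listed ones can have a nonzero
    -- coefficient, so searching the list decides.
    occurs? : ∀ v (f : Polynomial n) → Dec (Occurs v f)
    occurs? v f = map′ found listed (any? (λ (_ , m) → ¬? (coeff f m ≟ᶜ 0ᶜ) ×-dec (0 ℕ.<? m v)) f)
      where
      found : Any (λ (_ , m) → ¬ (coeff f m ≈ᶜ 0ᶜ) × 0 ℕ.< m v) f → Occurs v f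
      found any = let (_ , m) , occurs = Any.satisfied any in m , occurs
      listed : Occurs v f → Any (λ (_ , m) → ¬ (coeff f m ≈ᶜ 0ᶜ) × 0 ℕ.< m v) f
      listed (m , nz , 0<mv) = Any.map
        (λ {(_ , m′)} m′≗m →
          (λ ≈0 → nz (𝐂.trans (coeff-≗ f (≡.sym ∘ m′≗m)) ≈0)) , ≡.subst (0 ℕ.<_) (≡.sym (m′≗m v)) 0<mv)
        (coeff-listed f nz)

    ¬occurs⇒coeff≈0 : ∀ {v} {f : Polynomial n} → ¬ Occurs v f → ∀ m → 0 ℕ.< m v → coeff f m ≈ᶜ 0ᶜ
    ¬occurs⇒coeff≈0 {v} {f} ¬occurs m 0<mv =
      decidable-stable (coeff f m ≟ᶜ 0ᶜ) λ nz → ¬occurs (m , nz , 0<mv)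

    -- With values i t on the diagonal and t off it, t > 0, Im M is diagonal.

    unit : Variable n → ℂ
    unit v with row v Fin.≟ col v
    ... | yes _ = 𝕚
    ... | no  _ = 1ᶜ

    Value : Variable n → ℂ → Set
    Value v w = ∃ λ t → 0# < t × w ≈ᶜ ι t *ᶜ unit v

    abstract

      N-unit : ∀ v → N (unit v) ≈ 1#
      N-unit v with row v Fin.≟ col v
      ... | yes _ = solve 0 (con (+ 0) :* con (+ 0) :+ con (+ 1) :* con (+ 1) := con (+ 1)) refl
      ... | no  _ = solve 0 (con (+ 1) :* con (+ 1) :+ con (+ 0) :* con (+ 0) := con (+ 1)) refl

      value-diagonal : ∀ {v w} → row v ≡ col v → Value v w → 0# < im w
      value-diagonal {v} row≡col (t , 0<t , _ , im≈) with row v Fin.≟ col v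
      ... | yes _       = <-respʳ (trans (solve 1 (λ t → t := t :* con (+ 1) :+ con (+ 0) :* con (+ 0)) refl t) (sym im≈)) 0<t
      ... | no  row≢col = ⊥-elim (row≢col row≡col)

      value-off-diagonal : ∀ {v w} → row v ≢ col v → Value v w → im w ≈ 0#
      value-off-diagonal {v} row≢col (t , 0<t , _ , im≈) with row v Fin.≟ col v
      ... | yes row≡col = ⊥-elim (row≢col row≡col)
      ... | no  _       = trans im≈ (solve 1 (λ t → t :* con (+ 0) :+ con (+ 0) :* con (+ 1) := con (+ 0)) refl t)

      -- The admissible values form a ray, and far out on it a polynomial with a nonzero coefficient
      -- is bounded away from zero.
      value-avoids-roots : ∀ v a D → Nonzero a D → ∃ λ w → Value v w × ¬ (poly a D w ≈ᶜ 0ᶜ)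
      value-avoids-roots v a D nz =
        let ε , ρ , 0<ε , away = nonzero⇒away a D nz
            s , 1≤s , ρ≤ss = large-square ρ
            Nw≈ss = trans (N-* (ι s) (unit v)) (trans (*-cong (N-ι s) (N-unit v)) (*-identityʳ _))
        in ι s *ᶜ unit v , (s , <-≤-trans 0<1 1≤s , 𝐂.refl)
         , 0<N⇒≉0 (<-≤-trans 0<ε (away _ (≤-trans (ρ≤ss ≤-refl) (≤-reflexive (sym Nw≈ss)))))

    row-col-entry : ∀ (p q : Fin n) → let v = entry p q in (row v ≡ p × col v ≡ q) ⊎ (row v ≡ q × col v ≡ p)
    row-col-entry p q = entry-injective (entry-row-col (entry p q))

    row≡col : ∀ (p : Fin n) → row (entry p p) ≡ col (entry p p)
    row≡col p = [ (λ (r , c) → ≡.trans r (≡.sym c)) , (λ (r , c) → ≡.trans r (≡.sym c)) ]′ (row-col-entry p p)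

    row≢col : ∀ {p q : Fin n} → p ≢ q → row (entry p q) ≢ col (entry p q)
    row≢col {p} {q} p≢q eq =
      [ (λ (r , c) → p≢q (≡.trans (≡.sym r) (≡.trans eq c)))
      , (λ (r , c) → p≢q (≡.sym (≡.trans (≡.sym r) (≡.trans eq c)))) ]′ (row-col-entry p q)

    entry-diagonal≢ : ∀ {p q r : Fin n} → p ≢ q → entry p q ≢ entry r r
    entry-diagonal≢ p≢q eq =
      [ (λ (p≡r , q≡r) → p≢q (≡.trans p≡r (≡.sym q≡r)))
      , (λ (p≡r , q≡r) → p≢q (≡.trans p≡r (≡.sym q≡r))) ]′ (entry-injective eq)

    module _ {k l : Fin n} (k≢l : k ≢ l) (x : Variable n → ℂ)
      (valid : ∀ v → v ≢ entry k l → Value v (x v)) where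

      private
        y = im (x (entry k l))
        dₗ>0 = value-diagonal (row≡col l) (valid (entry l l) (entry-diagonal≢ k≢l ∘ ≡.sym))
        dₗ⁻¹ = proj₁ (inverse-pos dₗ>0)
        -- Chosen so that dₖ dₗ = y² + 1, which gives the (k, l) block of the imaginary part
        -- determinant 1.
        dₖ = (y * y + 1#) * dₗ⁻¹

      filled : Variable n → ℂ
      filled = x [ entry k k ≔ 0# +i dₖ ]

      filledMatrix : Matrix ℂ n
      filledMatrix p q = filled (entry p q)

      filledMatrix-positiveDefinite : PositiveDefinite (Im filledMatrix)
      filledMatrix-positiveDefinite = block-positiveDefinite k≢l (Im filledMatrix) diagonal off-diagonal
        (at-other (entry-diagonal≢ k≢l))
        (trans (reflexive (≡.cong (im ∘ filled) (entry-sym l k))) (at-other (entry-diagonal≢ k≢l)))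
        (trans (*-cong at-k (at-other λ eq → k≢l (≡.sym ([ proj₁ , proj₁ ]′ (entry-injective eq)))))
          (trans (solve 3 (λ a b c → a :* b :* c := a :* (c :* b)) refl (y * y + 1#) dₗ⁻¹ _)
            (trans (*-congˡ (proj₂ (proj₂ (inverse-pos dₗ>0)))) (*-identityʳ _))))
        where
        at-k : im (filled (entry k k)) ≈ dₖ
        at-k = reflexive (≡.cong im ([]≔-eq x (entry k k) (0# +i dₖ)))
        at-other : ∀ {v} → v ≢ entry k k → im (filled v) ≈ im (x v)
        at-other v≢ = reflexive (≡.cong im ([]≔-≢ x (0# +i dₖ) v≢))
        diagonal : ∀ p → 0# < im (filled (entry p p))
        diagonal p with p Fin.≟ k
        ... | yes ≡.refl = <-respʳ (sym at-k) (*-pos (nonneg+pos (0≤x*x y) 0<1) (proj₁ (proj₂ (inverse-pos dₗ>0))))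
        ... | no  p≢k = <-respʳ
          (sym (at-other λ eq → p≢k ([ proj₁ , proj₁ ]′ (entry-injective eq))))
          (value-diagonal (row≡col p) (valid (entry p p) (entry-diagonal≢ k≢l ∘ ≡.sym)))
        off-diagonal : ∀ p q → p ≢ q → ¬ (p ≡ k × q ≡ l) → ¬ (p ≡ l × q ≡ k) → im (filled (entry p q)) ≈ 0#
        off-diagonal p q p≢q ≢kl ≢lk = trans (at-other (entry-diagonal≢ p≢q))
          (value-off-diagonal (row≢col p≢q) (valid (entry p q) ([ ≢kl , ≢lk ]′ ∘ entry-injective)))

    -- Assuming k ≢ l rather than k < l lets both diagonal variables be reached by exchanging k and
    -- l.
    psdStable⇒diagonal-occurs : ∀ f → PsdStable f → ∀ {k l : Fin n} → k ≢ l →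
      Occurs (entry k l) f → Occurs (entry k k) f
    psdStable⇒diagonal-occurs f stable {k} {l} k≢l (m₀ , nz , 0<m₀) =
      decidable-stable (occurs? (entry k k) f) λ ¬occurs →
        let us , perm = ∈∈⇒↭ (entry-diagonal≢ k≢l) (∈-variables (entry k l)) (∈-variables (entry k k))
            coeff≈′ = λ m → 𝐂.trans (coeff≈ f m) (∑-cong f λ m′ → ∏-↭ (λ v → δ (m′ v) (m v)) perm)
        in root-independent-of Value value-avoids-roots {λ v → ι 1# *ᶜ unit v} (λ v → 1# , 0<1 , 𝐂.refl)
             fundamental-theorem-of-algebra f (unique-↭ perm (variables-unique n))
             (λ m 0<m → 𝐂.trans (𝐂.sym (coeff≈′ m)) (¬occurs⇒coeff≈0 {entry k k} {f} ¬occurs m 0<m))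
             m₀ 0<m₀ (λ ≈0 → nz (𝐂.trans (coeff≈′ m₀) ≈0))
             -- `vanish` holds for every value at (k, k), so that entry can be chosen last, when the
             -- imaginary part of the root at (k, l) is known.
             λ (x , valid , vanish) →
               let M = filledMatrix k≢l x valid
               in stable M (λ p q → 𝐂.reflexive (≡.cong (filled k≢l x valid) (entry-sym p q)))
                    (filledMatrix-positiveDefinite k≢l x valid)
                    (𝐂.trans (eval≈ f M) (𝐂.trans (∑-cong f λ m → 𝐂.trans
                      (∏-cong-All (All.universal (λ v → 𝐂.reflexive
                        (≡.cong (λ w → filled k≢l x valid w ^ᶜ m v) (entry-row-col v))) (variables n)))
                      (∏-↭ (λ v → filled k≢l x valid v ^ᶜ m v) perm))
                      (vanish _)))

open import Data.Fin.Base using (_<_)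
open import Data.Fin.Properties using (≤-refl)
open import Data.Nat.Properties using (<⇒≤)

theorem5p1 : (R : CompleteOrderedField) → let open PsdStability R in
    (n : ℕ) (f : Polynomial n) → PsdStable f →
    (i j : Fin n) (i<j : i < j) → Occurs (z i j (<⇒≤ i<j)) f →
    Occurs (z i i ≤-refl) f × Occurs (z j j ≤-refl) f
theorem5p1 R n f stable i j i<j occurs =
    diagonal (psdStable⇒diagonal-occurs f stable i≢j occursᵢⱼ)
  -- The same argument with i and j exchanged, as `entry` ignores their order.
  , diagonal (psdStable⇒diagonal-occurs f stable (i≢j ∘ ≡.sym) (≡.subst (λ v → Occurs v f) (entry-sym i j) occursᵢⱼ))
  where
  open PsdStability R
  open Variables
  open PsdStability⇒Occurrence R
  i≢j : i ≢ j
  i≢j = Fin.<⇒≢ i<j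
  occursᵢⱼ : Occurs (entry i j) f
  occursᵢⱼ = ≡.subst (λ v → Occurs v f) (≡.sym (entry-z (<⇒≤ i<j))) occurs
  diagonal : ∀ {k} → Occurs (entry k k) f → Occurs (z k k ≤-refl) f
  diagonal {k} = ≡.subst (λ v → Occurs v f) (entry-z {p = k} ≤-refl)
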